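{- Every oriented tree of order $n$ with $k$ leaves is $\left(\frac32 n+\frac32 k-2\right)$-unavoidable.
   Context: A tournament is an orientation of a complete graph. A digraph $D$ is $m$-unavoidable if every tournament of order $m$ (for non-integer $m$, every tournament with at least $m$ vertices suffices to be read as order $\lceil m\rceil$) contains $D$ as a subdigraph. An oriented tree is an orientation of a tree. A leaf of an oriented tree is a vertex adjacent to at most one vertex. -}

module Defs where

open import Data.Nat using (ℕ; _≤_; _≤?_; ⌈_/2⌉; _*_; _+_; _∸_)
open import Data.Fin using (Fin)
open import Data.Bool using (Bool; true; false; _∨_; if_then_else_)
open import Data.List using (List; []; _∷_; length; filter; map)
open import Data.Nat.ListAction using (sum)
open import Data.List.Relation.Unary.Unique.Propositional using (Unique)
open import Data.List.Base using (head)
open import Data.Fin.Base using ()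
open import Data.List using (allFin)
open import Data.Product using (Σ; _×_; ∃)
open import Data.Sum using (_⊎_)
open import Data.Empty using (⊥)
open import Relation.Nullary using (¬_)
open import Relation.Binary.PropositionalEquality using (_≡_; _≢_)
open import Function.Definitions using (Injective)

Digraph : ℕ → Set
Digraph n = Fin n → Fin n → Bool

adj : ∀ {n} → Digraph n → Fin n → Fin n → Bool
adj D u v = D u v ∨ D v u

record Tournament (m : ℕ) : Set where
  field
    arc     : Digraph m
    irrefl  : ∀ v → arc v v ≡ false
    total   : ∀ u v → u ≢ v → arc u v ≡ true ⊎ arc v u ≡ true
    antisym : ∀ u v → arc u v ≡ true → arc v u ≡ false

data Walk {n} (D : Digraph n) : Fin n → List (Fin n) → Fin n → Set where
  single : ∀ v → Walk D v (v ∷ []) v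
  step   : ∀ {u v w vs} → adj D u v ≡ true → Walk D v vs w → Walk D u (u ∷ vs) w

Connected : ∀ {n} → Digraph n → Set
Connected {n} D = ∀ (u v : Fin n) → Σ (List (Fin n)) λ vs → Walk D u vs v

HasCycle : ∀ {n} → Digraph n → Set
HasCycle {n} D =
  Σ (Fin n) λ u → Σ (Fin n) λ w → Σ (List (Fin n)) λ vs →
    Walk D u vs w × Unique vs × (3 ≤ length vs) × (adj D w u ≡ true)

record OrientedTree (n : ℕ) : Set where
  field
    arc       : Digraph n
    irrefl    : ∀ v → arc v v ≡ false
    oriented  : ∀ u v → arc u v ≡ true → arc v u ≡ false
    connected : Connected arc
    acyclic   : ¬ HasCycle arc

degree : ∀ {n} → Digraph n → Fin n → ℕ
degree {n} D v = sum (map (λ u → if adj D v u then 1 else 0) (allFin n))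

numLeaves : ∀ {n} → Digraph n → ℕ
numLeaves {n} D = length (filter (λ v → degree D v ≤? 1) (allFin n))

ContainsDigraph : ∀ {n m} → Tournament m → Digraph n → Set
ContainsDigraph {n} {m} T D =
  Σ (Fin n → Fin m) λ f → Injective _≡_ _≡_ f ×
    (∀ u v → D u v ≡ true → Tournament.arc T (f u) (f v) ≡ true)

Unavoidable : ∀ {n} → ℕ → Digraph n → Set
Unavoidable m D = ∀ (T : Tournament m) → ContainsDigraph T D

{-# OPTIONS --safe #-}
module Submission where

-- Order the tournament so that every vertex dominates at least half of each initial segment of its
-- successors.  An out-arborescence with n nodes and k leaves is embedded greedily in the first
-- n + k - 1 vertices: scan them in order, and let each vertex hit by a node take its first free
-- out-neighbours as images of the children.  If a vertex i is passed over while p < i is the last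
-- vertex with a child beyond i, the out-neighbours of p in (p , i] were all hit when p was scanned;
-- they are at least half of (p , i], and each accounts for a leaf of its own in (p , i].  So at any
-- time at most as many vertices have been passed over as leaves have been scanned.  The count does
-- not depend on which node is put on which of the chosen vertices.
--
-- In a rooted oriented tree, the edges towards the root form in-arborescences.  Let a vertex take,
-- instead of one out-neighbour per out-child u, a block large enough to contain the in-arborescence
-- through u wherever the block lies (the same statement for the reversed tournament), and treat the
-- unused vertices of the block as leaves.  The vertices needed for this and for the reversed tree
-- add up to at most 3 n + 3 k - 4, so one of the two embeddings fits.

open import Defs
open import Data.Nat using (ℕ; zero; suc; _+_; _*_; _∸_; _≤_; _<_; _≤?_; ⌈_/2⌉; ⌊_/2⌋; z≤n; s≤s; s≤s⁻¹)
open import Data.Nat.Properties hiding (_≟_)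
open import Data.Nat.ListAction using (sum)
open import Data.Nat.ListAction.Properties using (sum-++; sum-↭)
open import Data.Nat.Tactic.RingSolver using (solve-∀)
open import Data.Bool using (Bool; true; false; _∨_; if_then_else_)
open import Data.Bool.Properties using (∨-comm; ∨-zeroʳ)
open import Data.Empty using (⊥-elim)
open import Data.Fin using (Fin; _≟_)
open import Data.Fin.Properties using (all?; ¬∀⟶∃¬)
open import Data.List using (List; []; _∷_; _++_; length; map; take; drop; allFin)
open import Data.List.Properties using (length-map; length-++; length-take; length-drop;
  length-tabulate; map-++; map-∘; map-id; take++drop≡id; ∷-injective)
open import Data.List.Membership.Propositional using (_∈_; _∉_)
open import Data.List.Membership.Propositional.Properties using (∈-++⁺ˡ; ∈-++⁺ʳ; ∈-++⁻; ∈-map⁺;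
  ∈-allFin; ∈-∃++; ∈-filter⁺)
import Data.List.Membership.DecPropositional as DecMembership
open import Data.List.Relation.Binary.Permutation.Propositional using (_↭_; prep; swap; ↭-refl;
  ↭-sym; ↭-trans; ↭-reflexive; ↭⇒↭ₛ)
open import Data.List.Relation.Binary.Permutation.Propositional.Properties using (map⁺; ++⁺ˡ; ++⁺ʳ;
  shift; ↭-length; ↭-map-inv; ∈-resp-↭)
open import Data.List.Relation.Binary.Permutation.Setoid.Properties using (Unique-resp-↭)
open import Data.List.Relation.Unary.All using (All; []; _∷_)
import Data.List.Relation.Unary.All as All
import Data.List.Relation.Unary.All.Properties as All
open import Data.List.Relation.Unary.AllPairs using ([]; _∷_)
open import Data.List.Relation.Unary.Any using (here; there)
open import Data.List.Relation.Unary.Unique.Propositional using (Unique)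
import Data.List.Relation.Unary.Unique.Propositional.Properties as Unique
open import Data.Maybe using (Maybe; just; nothing)
open import Data.Product using (∃; ∃₂; _×_; _,_; proj₁; proj₂)
open import Data.Sum using (_⊎_; inj₁; inj₂; [_,_]′)
open import Function using (_∘_; flip)
open import Relation.Binary.Definitions using (DecidableEquality)
open import Relation.Binary.PropositionalEquality
open import Relation.Nullary using (¬_; yes; no)

unique-↭ : ∀ {A : Set} {xs ys : List A} → xs ↭ ys → Unique xs → Unique ys
unique-↭ p = Unique-resp-↭ (setoid _) (↭⇒↭ₛ p)

-- Local median orders.

module MedianOrders {V : Set} (arc : V → V → Bool) where

  -- `Leads v δ ws`: in every initial segment of `ws`, at most δ more vertices beat v than lose to it.
  data Leads (v : V) : ℕ → List V → Set where
    []   : ∀ {δ} → Leads v δ []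
    win  : ∀ {δ w ws} → arc v w ≡ true  → Leads v (suc δ) ws → Leads v δ (w ∷ ws)
    lose : ∀ {δ w ws} → arc v w ≡ false → Leads v δ ws → Leads v (suc δ) (w ∷ ws)

  -- The forward-looking half of the feedback property of median orders.
  data Median : List V → Set where
    []  : Median []
    _∷_ : ∀ {v vs} → Leads v 0 vs → Median vs → Median (v ∷ vs)

  -- `losses v ws` is charged when `v` stands in front of `ws`, `backs v ws` when it stands behind.
  losses wins backs : V → List V → ℕ
  losses v ws = sum (map (λ w → if arc v w then 0 else 1) ws)
  wins   v ws = sum (map (λ w → if arc v w then 1 else 0) ws)
  backs  v ws = sum (map (λ w → if arc w v then 0 else 1) ws)

  -- The potential that a median order minimises and that `improve` lowers.
  backward : List V → ℕ
  backward []       = 0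
  backward (v ∷ vs) = losses v vs + backward vs

  losses-++ : ∀ v as bs → losses v (as ++ bs) ≡ losses v as + losses v bs
  losses-++ v as bs = trans (cong sum (map-++ _ as bs)) (sum-++ (map _ as) _)

  -- The alternative to `Leads` is an explicit bad initial segment `as`; `improve` moves `v` behind
  -- it.
  leads? : ∀ v δ ws → Leads v δ ws ⊎
           ∃₂ λ as bs → ws ≡ as ++ bs × δ + wins v as < losses v as
  leads? v δ [] = inj₁ []
  leads? v δ (w ∷ ws) with arc v w in eq
  leads? v δ (w ∷ ws) | true with leads? v (suc δ) ws
  ... | inj₁ l = inj₁ (win eq l)
  ... | inj₂ (as , bs , refl , lt) = inj₂ (w ∷ as , bs , refl , lt′)
    where
    lt′ : δ + wins v (w ∷ as) < losses v (w ∷ as)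
    lt′ rewrite eq | +-suc δ (wins v as) = lt
  leads? v zero (w ∷ ws) | false = inj₂ (w ∷ [] , ws , refl , lt′)
    where
    lt′ : 0 + wins v (w ∷ []) < losses v (w ∷ [])
    lt′ rewrite eq = s≤s z≤n
  leads? v (suc δ) (w ∷ ws) | false with leads? v δ ws
  ... | inj₁ l = inj₁ (lose eq l)
  ... | inj₂ (as , bs , refl , lt) = inj₂ (w ∷ as , bs , refl , lt′)
    where
    lt′ : suc δ + wins v (w ∷ as) < losses v (w ∷ as)
    lt′ rewrite eq = s≤s lt

  module _ (total : ∀ u v → u ≢ v → arc u v ≡ true ⊎ arc v u ≡ true) where

    backs≤wins : ∀ {v as} → All (v ≢_) as → backs v as ≤ wins v as
    backs≤wins [] = z≤n
    backs≤wins {v} {a ∷ as} (v≢a ∷ v≢as) with arc a v in eq | arc v a in eq′ | total v a v≢a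
    ... | true  | _     | _       = ≤-trans (backs≤wins v≢as) (m≤n+m _ _)
    ... | false | true  | _       = s≤s (backs≤wins v≢as)
    ... | false | false | inj₁ ()
    ... | false | false | inj₂ ()

    backward-insert : ∀ v as bs →
      backward (as ++ v ∷ bs) ≡ backward (as ++ bs) + backs v as + losses v bs
    backward-insert v [] bs = trans (+-comm (losses v bs) _) (cong (_+ losses v bs) (sym (+-identityʳ _)))
    backward-insert v (a ∷ as) bs
      rewrite losses-++ a as (v ∷ bs) | losses-++ a as bs | backward-insert v as bs =
      shuffle (losses a as) _ (losses a bs) (backward (as ++ bs)) (backs v as) (losses v bs)
      where
      shuffle : ∀ p q r s t u → p + (q + r) + (s + t + u) ≡ p + r + s + (q + t) + u
      shuffle = solve-∀

    -- Only the pairs of `v` with a member of `as` change their order. Their contribution drops from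
    -- `losses v as` to `backs v as`, which by totality is at most `wins v as`.
    move-decreases : ∀ v as bs → All (v ≢_) as → wins v as < losses v as →
      backward (as ++ v ∷ bs) < backward (v ∷ as ++ bs)
    move-decreases v as bs v≢as lt
      rewrite backward-insert v as bs | losses-++ v as bs = begin-strict
      backward (as ++ bs) + backs v as + losses v bs
        <⟨ +-monoˡ-< (losses v bs) (+-monoʳ-< (backward (as ++ bs)) (≤-<-trans (backs≤wins v≢as) lt)) ⟩
      backward (as ++ bs) + losses v as + losses v bs
        ≡⟨ shuffle (backward (as ++ bs)) (losses v as) (losses v bs) ⟩
      losses v as + losses v bs + backward (as ++ bs) ∎
      where
      open ≤-Reasoning
      shuffle : ∀ p q r → p + q + r ≡ q + r + p
      shuffle = solve-∀

    improve : ∀ vs → Unique vs → Median vs ⊎ ∃ λ ws → vs ↭ ws × backward ws < backward vs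
    improve [] _ = inj₁ []
    improve (v ∷ vs) (v≢vs ∷ u) with improve vs u
    ... | inj₂ (ws , p , lt) = inj₂ (v ∷ ws , prep v p ,
          subst (λ l → l + backward ws < losses v vs + backward vs)
                (sum-↭ (map⁺ (λ w → if arc v w then 0 else 1) p)) (+-monoʳ-< (losses v vs) lt))
    ... | inj₁ m with leads? v 0 vs
    ...   | inj₁ l = inj₁ (l ∷ m)
    ...   | inj₂ (as , bs , refl , lt) =
            inj₂ (as ++ v ∷ bs , ↭-sym (shift v as bs) , move-decreases v as bs (All.++⁻ˡ as v≢vs) lt)

    medianOrder : ∀ vs → Unique vs → ∃ λ ws → vs ↭ ws × Median ws
    medianOrder vs u = go (backward vs) vs u ≤-refl
      where
      go : ∀ k vs → Unique vs → backward vs ≤ k → ∃ λ ws → vs ↭ ws × Median ws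
      go k vs u b≤k with improve vs u
      ... | inj₁ m = vs , ↭-refl , m
      go zero vs u b≤k | inj₂ (ws , p , lt) = ⊥-elim (n≮0 (<-≤-trans lt b≤k))
      go (suc k) vs u b≤k | inj₂ (ws , p , lt)
        with go k ws (unique-↭ p u) (s≤s⁻¹ (<-≤-trans lt b≤k))
      ... | xs , q , m = xs , ↭-trans p q , m

-- Greedy embedding along a median order.

module Greedy
  {V : Set} (arc : V → V → Bool) {Task : Set}
  -- `cost t` stands for the nodes plus the leaves still to come below and including `t`; `own` and
  -- `tot` carry along an arbitrary weight that does not grow when tasks are spawned.
  (demand cost own tot : Task → ℕ)
  (2≤cost : ∀ t → 2 ≤ cost t)
  -- This keeps the free out-neighbours from running out, see `demand-met`.
  (2demand<cost : ∀ t → 2 * demand t < cost t)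
  (Spawn : V × Task → List (V × Task) → Set)
  -- The vertices are chosen before the tasks are assigned to them, so a family may be arranged
  -- according to the arcs between its vertices.
  (spawn : ∀ v t vs → Unique vs → All (λ w → arc v w ≡ true) vs → length vs ≡ demand t →
    ∃ λ ks → map proj₁ ks ≡ vs
           × sum (map (cost ∘ proj₂) ks) < cost t
           × own t + sum (map (tot ∘ proj₂) ks) ≤ tot t
           × Spawn (v , t) ks)
  where

  open MedianOrders arc

  Slot : Set
  Slot = V × Maybe Task

  Family : Set
  Family = List (V × Task)

  verts : List Slot → List V
  verts = map proj₁

  Placed : Family → List Slot → Set
  Placed ks R = ∀ {x t} → (x , t) ∈ ks → (x , just t) ∈ R

  Blank : List Slot → Set
  Blank = All (λ s → proj₂ s ≡ nothing)

  load : (Task → ℕ) → List Slot → ℕ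
  load f []                = 0
  load f ((_ , nothing) ∷ R) = load f R
  load f ((_ , just t) ∷ R)  = f t + load f R

  -- Read σ as leaves scanned minus vertices passed over so far.  The invariant of the scan is that σ,
  -- increased for each slot already hit and decreased for each free one, stays nonnegative up to the
  -- last hit slot.
  data Solvent : ℕ → List Slot → Set where
    blank : ∀ {σ R} → Blank R → Solvent σ R
    hit   : ∀ {σ v t R} → Solvent (suc σ) R → Solvent σ ((v , just t) ∷ R)
    free  : ∀ {σ v R} → Solvent σ R → Solvent (suc σ) ((v , nothing) ∷ R)

  solvent-suc : ∀ {σ R} → Solvent σ R → Solvent (suc σ) R
  solvent-suc (blank b) = blank b
  solvent-suc (hit s)   = hit (solvent-suc s)
  solvent-suc (free s)  = free (solvent-suc s)

  hit⁻¹ : ∀ {σ v t R} → Solvent σ ((v , just t) ∷ R) → Solvent (suc σ) R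
  hit⁻¹ (blank (() ∷ _))
  hit⁻¹ (hit s) = s

  free⁻¹ : ∀ {σ v R} → Solvent (suc σ) ((v , nothing) ∷ R) → Solvent σ R
  free⁻¹ (blank (_ ∷ b)) = blank b
  free⁻¹ (free s)        = s

  -- Since `skip` demands a non-neighbour, a derivation certifies that no free out-neighbour in
  -- front of the last new hit was passed by. `fill-solvent` rests on this.
  data Fill (v : V) : Family → List Slot → List Slot → Set where
    done : ∀ {R} → Fill v [] R R
    put  : ∀ {w t ks R R′} → arc v w ≡ true → Fill v ks R R′ →
           Fill v ((w , t) ∷ ks) ((w , nothing) ∷ R) ((w , just t) ∷ R′)
    skip : ∀ {k ks w R R′} → arc v w ≡ false → Fill v (k ∷ ks) R R′ →
           Fill v (k ∷ ks) ((w , nothing) ∷ R) ((w , nothing) ∷ R′)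
    pass : ∀ {k ks w t R R′} → Fill v (k ∷ ks) R R′ →
           Fill v (k ∷ ks) ((w , just t) ∷ R) ((w , just t) ∷ R′)

  fill-verts : ∀ {v ks R R′} → Fill v ks R R′ → verts R′ ≡ verts R
  fill-verts done       = refl
  fill-verts (put _ f)  = cong (_ ∷_) (fill-verts f)
  fill-verts (skip _ f) = cong (_ ∷_) (fill-verts f)
  fill-verts (pass f)   = cong (_ ∷_) (fill-verts f)

  fill-load : ∀ g {v ks R R′} → Fill v ks R R′ → load g R′ ≡ sum (map (g ∘ proj₂) ks) + load g R
  fill-load g done = refl
  fill-load g (put {t = t} _ f) = trans (cong (g t +_) (fill-load g f)) (sym (+-assoc (g t) _ _))
  fill-load g (skip _ f) = fill-load g f
  fill-load g (pass {k} {ks} {t = t} f) = trans (cong (g t +_) (fill-load g f)) 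
    (shuffle (g t) (sum (map (g ∘ proj₂) (k ∷ ks))) _)
    where
    shuffle : ∀ a b c → a + (b + c) ≡ b + (a + c)
    shuffle = solve-∀

  fill-keeps : ∀ {v ks R R′ x t} → Fill v ks R R′ → (x , just t) ∈ R → (x , just t) ∈ R′
  fill-keeps done       i         = i
  fill-keeps (put _ f)  (there i) = there (fill-keeps f i)
  fill-keeps (skip _ f) (there i) = there (fill-keeps f i)
  fill-keeps (pass f)   (here e)  = here e
  fill-keeps (pass f)   (there i) = there (fill-keeps f i)

  fill-places : ∀ {v ks R R′} → Fill v ks R R′ → Placed ks R′
  fill-places (put _ f)  (here refl) = here refl
  fill-places (put _ f)  (there i)   = there (fill-places f i)
  fill-places (skip _ f) i           = there (fill-places f i)
  fill-places (pass f)   i           = there (fill-places f i)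

  fill-new : ∀ {v ks R R′ x t} → Fill v ks R R′ → (x , just t) ∈ R′ → (x , just t) ∈ R ⊎ (x , t) ∈ ks
  fill-new done i = inj₁ i
  fill-new (put _ f) (here refl) = inj₂ (here refl)
  fill-new (put _ f) (there i) with fill-new f i
  ... | inj₁ j = inj₁ (there j)
  ... | inj₂ j = inj₂ (there j)
  fill-new (skip _ f) (there i) with fill-new f i
  ... | inj₁ j = inj₁ (there j)
  ... | inj₂ j = inj₂ j
  fill-new (pass f) (here e) = inj₁ (here e)
  fill-new (pass f) (there i) with fill-new f i
  ... | inj₁ j = inj₁ (there j)
  ... | inj₂ j = inj₂ j

  -- Up to the last new hit every out-neighbour of v is hit, so `Leads` bounds the free slots there;
  -- from then on R′ has gained more than the one hit slot (that of v) which was removed in front.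
  fill-solvent : ∀ {v k ks R R′ δ σ} → Fill v (k ∷ ks) R R′ → Leads v δ (verts R) → δ ≤ σ →
                 Solvent (suc σ) R → Solvent σ R′
  fill-solvent (put _ done) _ _ s = hit (solvent-suc (free⁻¹ s))
  fill-solvent {ks = _ ∷ _} (put _ f) (win _ l) δ≤σ s =
    hit (fill-solvent f l (s≤s δ≤σ) (solvent-suc (solvent-suc (free⁻¹ s))))
  fill-solvent {ks = _ ∷ _} (put a _) (lose b _) _ _ with () ← trans (sym a) b
  fill-solvent (skip b _) (win a _) _ _ with () ← trans (sym a) b
  fill-solvent (skip _ f) (lose _ l) (s≤s δ≤σ) s = free (fill-solvent f l δ≤σ (free⁻¹ s))
  fill-solvent (pass f) (win _ l)  δ≤σ s = hit (fill-solvent f l (s≤s δ≤σ) (hit⁻¹ s))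
  fill-solvent (pass f) (lose _ l) δ≤σ s =
    hit (fill-solvent f l (≤-trans (n≤1+n _) (m≤n⇒m≤1+n δ≤σ)) (hit⁻¹ s))

  freeOut : V → List Slot → List V
  freeOut v [] = []
  freeOut v ((w , nothing) ∷ R) = if arc v w then w ∷ freeOut v R else freeOut v R
  freeOut v ((w , just _) ∷ R)  = freeOut v R

  freeOut-arc : ∀ v R → All (λ w → arc v w ≡ true) (freeOut v R)
  freeOut-arc v [] = []
  freeOut-arc v ((w , nothing) ∷ R) with arc v w in eq
  ... | true  = eq ∷ freeOut-arc v R
  ... | false = freeOut-arc v R
  freeOut-arc v ((w , just _) ∷ R) = freeOut-arc v R

  freeOut-all : ∀ {p} {P : V → Set p} v R → All P (verts R) → All P (freeOut v R)
  freeOut-all v [] _ = []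
  freeOut-all v ((w , nothing) ∷ R) (p ∷ ps) with arc v w
  ... | true  = p ∷ freeOut-all v R ps
  ... | false = freeOut-all v R ps
  freeOut-all v ((w , just _) ∷ R) (p ∷ ps) = freeOut-all v R ps

  freeOut-unique : ∀ v R → Unique (verts R) → Unique (freeOut v R)
  freeOut-unique v [] _ = []
  freeOut-unique v ((w , nothing) ∷ R) (p ∷ u) with arc v w
  ... | true  = freeOut-all v R p ∷ freeOut-unique v R u
  ... | false = freeOut-unique v R u
  freeOut-unique v ((w , just _) ∷ R) (p ∷ u) = freeOut-unique v R u

  fill : ∀ v c R ks → map proj₁ ks ≡ take c (freeOut v R) → ∃ (Fill v ks R)
  fill v c R [] _ = R , done
  fill v zero R (_ ∷ _) ()
  fill v (suc c) [] (_ ∷ _) ()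
  fill v (suc c) ((w , nothing) ∷ R) (k ∷ ks) e with arc v w in eq
  fill v (suc c) ((w , nothing) ∷ R) ((_ , t) ∷ ks) e | true with ∷-injective e
  ... | refl , e′ with fill v c R ks e′
  ...   | R′ , f = (w , just t) ∷ R′ , put eq f
  fill v (suc c) ((w , nothing) ∷ R) (k ∷ ks) e | false with fill v (suc c) R (k ∷ ks) e
  ... | R′ , f = (w , nothing) ∷ R′ , skip eq f
  fill v (suc c) ((w , just t) ∷ R) (k ∷ ks) e with fill v (suc c) R (k ∷ ks) e
  ... | R′ , f = (w , just t) ∷ R′ , pass f

  -- Losses exceed wins by at most δ, so the length is at most δ plus twice the wins. A win is
  -- either a free out-neighbour or a hit slot, and the cost of a hit slot is at least 2.
  leads-length : ∀ {δ v} R → Leads v δ (verts R) →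
                 length R ≤ δ + 2 * length (freeOut v R) + load cost R
  leads-length [] _ = z≤n
  leads-length {δ} {v} ((w , nothing) ∷ R) (win a l) rewrite a = begin
    suc (length R)                                                 ≤⟨ s≤s (leads-length R l) ⟩
    suc (suc δ + 2 * length (freeOut v R) + load cost R)
      ≡⟨ shuffle δ (length (freeOut v R)) (load cost R) ⟩
    δ + 2 * suc (length (freeOut v R)) + load cost R               ∎
    where
    open ≤-Reasoning
    shuffle : ∀ d x y → suc (suc d + 2 * x + y) ≡ d + 2 * suc x + y
    shuffle = solve-∀
  leads-length ((w , nothing) ∷ R) (lose b l) rewrite b = s≤s (leads-length R l)
  leads-length {δ} {v} ((w , just t) ∷ R) (win a l) = begin
    suc (length R)                                                 ≤⟨ s≤s (leads-length R l) ⟩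
    suc (suc δ + 2 * length (freeOut v R) + load cost R)
      ≡⟨ shuffle δ (2 * length (freeOut v R)) (load cost R) ⟩
    δ + 2 * length (freeOut v R) + (2 + load cost R)
      ≤⟨ +-monoʳ-≤ (δ + 2 * length (freeOut v R)) (+-monoˡ-≤ (load cost R) (2≤cost t)) ⟩
    δ + 2 * length (freeOut v R) + (cost t + load cost R)          ∎
    where
    open ≤-Reasoning
    shuffle : ∀ d x y → suc (suc d + x + y) ≡ d + x + (2 + y)
    shuffle = solve-∀
  leads-length {suc δ} {v} ((w , just t) ∷ R) (lose b l) =
    s≤s (≤-trans (leads-length R l)
      (+-monoʳ-≤ (δ + 2 * length (freeOut v R)) (m≤n+m (load cost R) (cost t))))

  -- By `leads-length`, the budget bounds `cost t` by two more than twice the number of free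
  -- out-neighbours; `2demand<cost` is strict.
  demand-met : ∀ {v t σ} R → Leads v 0 (verts R) → cost t + load cost R + σ ≤ suc (suc (length R)) →
               demand t ≤ length (freeOut v R)
  demand-met {v} {t} {σ} R l budget = s≤s⁻¹ (*-cancelˡ-< 2 (demand t) (suc x) (+-cancelʳ-< y _ _ (begin-strict
    2 * demand t + y            <⟨ +-monoˡ-< y (2demand<cost t) ⟩
    cost t + y                  ≤⟨ m≤m+n _ σ ⟩
    cost t + y + σ              ≤⟨ budget ⟩
    suc (suc (length R))        ≤⟨ s≤s (s≤s (leads-length R l)) ⟩
    suc (suc (2 * x + y))       ≡⟨ shuffle x y ⟩
    2 * suc x + y               ∎)))
    where
    open ≤-Reasoning
    x = length (freeOut v R)
    y = load cost R
    shuffle : ∀ a b → suc (suc (2 * a + b)) ≡ 2 * suc a + b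
    shuffle = solve-∀

  -- `spawned` leads from a placed task down to its family, `origin` up to the family it came from.
  -- The upward direction is for relations between members of one family.
  record Run (R : List Slot) : Set where
    field
      final   : List Slot
      same    : verts final ≡ verts R
      weight  : load own final ≤ load tot R
      keeps   : ∀ {x t} → (x , just t) ∈ R → (x , just t) ∈ final
      spawned : ∀ {x t} → (x , just t) ∈ final → ∃ λ ks → Spawn (x , t) ks × Placed ks final
      origin  : ∀ {x t} → (x , just t) ∈ final → (x , just t) ∈ R ⊎
                ∃₂ λ y ks → Spawn y ks × (x , t) ∈ ks × Placed ks final

  load-blank : ∀ g {R} → Blank R → load g R ≡ 0
  load-blank g [] = refl
  load-blank g (_∷_ {_ , nothing} refl b) = load-blank g b

  blank-∉ : ∀ {R x t} → Blank R → ¬ ((x , just t) ∈ R)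
  blank-∉ b i with () ← All.lookup b i

  run-stop : ∀ R → Blank R → Run R
  run-stop R b = record
    { final = R ; same = refl ; weight = subst (_≤ load tot R) (sym (load-blank own b)) z≤n
    ; keeps = λ i → i ; spawned = ⊥-elim ∘ blank-∉ b ; origin = inj₁ }

  run-free : ∀ {v R} → Run R → Run ((v , nothing) ∷ R)
  run-free {v} {R} r = record
    { final = (v , nothing) ∷ final ; same = cong (v ∷_) same ; weight = weight
    ; keeps = λ { (there i) → there (keeps i) }
    ; spawned = λ { (there i) → let ks , sp , pl = spawned i in ks , sp , there ∘ pl }
    ; origin = λ { (there i) → relay (origin i) } }
    where
    open Run r
    relay : ∀ {x t} →
      (x , just t) ∈ R ⊎ (∃₂ λ y ks → Spawn y ks × (x , t) ∈ ks × Placed ks final) →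
      (x , just t) ∈ ((v , nothing) ∷ R) ⊎
      ∃₂ λ y ks → Spawn y ks × (x , t) ∈ ks × Placed ks ((v , nothing) ∷ final)
    relay (inj₁ i)                       = inj₁ (there i)
    relay (inj₂ (y , ks , sp , i , pl)) = inj₂ (y , ks , sp , i , there ∘ pl)

  run-hit : ∀ {v t ks R R′} → Spawn (v , t) ks → own t + sum (map (tot ∘ proj₂) ks) ≤ tot t →
            Fill v ks R R′ → Run R′ → Run ((v , just t) ∷ R)
  run-hit {v} {t} {ks} {R} {R′} sp light f r = record
    { final = (v , just t) ∷ final ; same = cong (v ∷_) (trans same (fill-verts f))
    ; weight = begin
        own t + load own final                                  ≤⟨ +-monoʳ-≤ (own t) weight ⟩
        own t + load tot R′                                     ≡⟨ cong (own t +_) (fill-load tot f) ⟩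
        own t + (sum (map (tot ∘ proj₂) ks) + load tot R)       ≡⟨ +-assoc (own t) _ _ ⟨
        own t + sum (map (tot ∘ proj₂) ks) + load tot R         ≤⟨ +-monoˡ-≤ (load tot R) light ⟩
        tot t + load tot R                                      ∎
    ; keeps = λ { (here refl) → here refl ; (there i) → there (keeps (fill-keeps f i)) }
    ; spawned = λ { (here refl) → ks , sp , there ∘ placed
                  ; (there i) → let ks′ , sp′ , pl = spawned i in ks′ , sp′ , there ∘ pl }
    ; origin = λ { (here refl) → inj₁ (here refl) ; (there i) → relay (origin i) } }
    where
    open Run r
    open ≤-Reasoning
    placed : Placed ks final
    placed i = keeps (fill-places f i)
    relay : ∀ {x s} →
      (x , just s) ∈ R′ ⊎ (∃₂ λ y ks → Spawn y ks × (x , s) ∈ ks × Placed ks final) →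
      (x , just s) ∈ ((v , just t) ∷ R) ⊎
      ∃₂ λ y ks → Spawn y ks × (x , s) ∈ ks × Placed ks ((v , just t) ∷ final)
    relay (inj₂ (y , ks′ , sp′ , i , pl)) = inj₂ (y , ks′ , sp′ , i , there ∘ pl)
    relay (inj₁ i) with fill-new f i
    ... | inj₁ j = inj₁ (there j)
    ... | inj₂ j = inj₂ ((v , t) , ks , sp , j , there ∘ placed)

  -- Each scanned slot lowers the right-hand side of the budget by one. A free slot pays with a unit
  -- of σ; a task without children pays with its cost of at least two, one unit of which passes to
  -- σ; any other task pays with the drop in cost from the task to its family.
  run : ∀ R → Median (verts R) → Unique (verts R) → ∀ σ → Solvent σ R →
        load cost R + σ ≤ suc (length R) → Run R
  run R m u σ = go (length R) R refl m u σ
    where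
    open ≤-Reasoning

    -- `fill` replaces the tail, so the recursion is on its length.
    go : ∀ k R → length R ≡ k → Median (verts R) → Unique (verts R) → ∀ σ → Solvent σ R →
         load cost R + σ ≤ suc (length R) → Run R
    go k [] _ _ _ _ _ _ = run-stop [] []
    -- For σ equal to 0 and a free slot in front, `Solvent` admits only `blank`: σ is never
    -- overdrawn.
    go k ((v , nothing) ∷ R) _ _ _ σ (blank b) _ = run-stop _ b
    go (suc k) ((v , nothing) ∷ R) e (_ ∷ m) (_ ∷ u) (suc σ) (free s) budget =
      run-free (go k R (suc-injective e) m u σ s
        (s≤s⁻¹ (subst (_≤ suc (suc (length R))) (+-suc (load cost R) σ) budget)))
    go (suc k) ((v , just t) ∷ R) e (l ∷ m) (v∉ ∷ u) σ s budget
      with spawn v t (take (demand t) (freeOut v R))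
             (Unique.take⁺ (demand t) (freeOut-unique v R u))
             (All.take⁺ (demand t) (freeOut-arc v R))
             (trans (length-take (demand t) (freeOut v R)) (m≤n⇒m⊓n≡m (demand-met R l budget)))
    ... | [] , _ , _ , light , sp =
          run-hit sp light done (go k R (suc-injective e) m u (suc σ) (hit⁻¹ s) (s≤s⁻¹ (begin
            suc (load cost R + suc σ)       ≡⟨ shuffle (load cost R) σ ⟩
            2 + load cost R + σ             ≤⟨ +-monoˡ-≤ σ (+-monoˡ-≤ (load cost R) (2≤cost t)) ⟩
            cost t + load cost R + σ        ≤⟨ budget ⟩
            suc (suc (length R))            ∎)))
      where
      shuffle : ∀ a b → suc (a + suc b) ≡ 2 + a + b
      shuffle = solve-∀
    ... | ks@(_ ∷ _) , e′ , cheap , light , sp with fill v (demand t) R ks e′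
    ...   | R′ , f =
          run-hit sp light f (go k R′ (trans same-length (suc-injective e))
            (subst Median (sym (fill-verts f)) m) (subst Unique (sym (fill-verts f)) u) σ
            (fill-solvent f l z≤n (hit⁻¹ s)) (s≤s⁻¹ (begin
              suc (load cost R′ + σ)
                ≡⟨ cong (λ x → suc (x + σ)) (fill-load cost f) ⟩
              suc (sum (map (cost ∘ proj₂) ks)) + load cost R + σ
                ≤⟨ +-monoˡ-≤ σ (+-monoˡ-≤ (load cost R) cheap) ⟩
              cost t + load cost R + σ
                ≤⟨ budget ⟩
              suc (suc (length R))
                ≡⟨ cong (suc ∘ suc) same-length ⟨
              suc (suc (length R′)) ∎)))
      where
      same-length : length R′ ≡ length R
      same-length = trans (sym (length-map proj₁ R′)) (trans (cong length (fill-verts f)) (length-map proj₁ R))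

  hits : Family → List Slot
  hits = map (λ k → proj₁ k , just (proj₂ k))

  frees : List V → List Slot
  frees = map (_, nothing)

  module _ (vs : List V) where

    frees-blank : Blank (frees vs)
    frees-blank = All.map⁺ (All.universal (λ _ → refl) vs)

    opening-verts : ∀ ks → verts (hits ks ++ frees vs) ≡ map proj₁ ks ++ vs
    opening-verts []       = trans (sym (map-∘ vs)) (map-id vs)
    opening-verts (k ∷ ks) = cong (proj₁ k ∷_) (opening-verts ks)

    opening-load : ∀ g ks → load g (hits ks ++ frees vs) ≡ sum (map (g ∘ proj₂) ks)
    opening-load g []       = load-blank g frees-blank
    opening-load g (k ∷ ks) = cong (g (proj₂ k) +_) (opening-load g ks)

    opening-solvent : ∀ σ ks → Solvent σ (hits ks ++ frees vs)
    opening-solvent σ []       = blank frees-blank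
    opening-solvent σ (k ∷ ks) = hit (opening-solvent (suc σ) ks)

    opening-new : ∀ ks {x t} → (x , just t) ∈ hits ks ++ frees vs → (x , t) ∈ ks
    opening-new []       i         = ⊥-elim (blank-∉ frees-blank i)
    opening-new (k ∷ ks) (here refl) = here refl
    opening-new (k ∷ ks) (there i)   = there (opening-new ks i)

    opening-places : ∀ ks → Placed ks (hits ks ++ frees vs)
    opening-places (k ∷ ks) (here refl) = here refl
    opening-places (k ∷ ks) (there i)   = there (opening-places ks i)

    -- The scan starts with σ equal to 0. The `suc` in the budget is the 1 subtracted in n + k - 1.
    play : ∀ ks → Median (map proj₁ ks ++ vs) → Unique (map proj₁ ks ++ vs) →
           sum (map (cost ∘ proj₂) ks) ≤ suc (length (map proj₁ ks ++ vs)) →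
           Run (hits ks ++ frees vs)
    play ks m u afford = run (hits ks ++ frees vs)
      (subst Median (sym eq) m) (subst Unique (sym eq) u) 0 (opening-solvent 0 ks) (begin
        load cost (hits ks ++ frees vs) + 0           ≡⟨ +-identityʳ _ ⟩
        load cost (hits ks ++ frees vs)               ≡⟨ opening-load cost ks ⟩
        sum (map (cost ∘ proj₂) ks)                   ≤⟨ afford ⟩
        suc (length (map proj₁ ks ++ vs))             ≡⟨ cong (suc ∘ length) eq ⟨
        suc (length (verts (hits ks ++ frees vs)))    ≡⟨ cong suc (length-map proj₁ (hits ks ++ frees vs)) ⟩
        suc (length (hits ks ++ frees vs))            ∎)
      where
      open ≤-Reasoning
      eq = opening-verts ks

-- Linking the first child destroys the leaf that the bare root was, linking a later one destroys
-- none. `positive (kids d t)` records this difference.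
positive : {A : Set} → List A → ℕ
positive []      = 0
positive (_ ∷ _) = 1

positive≤1 : ∀ {A : Set} (xs : List A) → positive xs ≤ 1
positive≤1 []      = z≤n
positive≤1 (_ ∷ _) = ≤-refl

-- Rooted oriented trees and their sizes.

data Dir : Set where
  fwd bwd : Dir

op : Dir → Dir
op fwd = bwd
op bwd = fwd

orient : ∀ {A B : Set} → Dir → (A → A → B) → A → A → B
orient fwd R = R
orient bwd R = flip R

-- `link d t s` hangs `s` below the root of `t`; the new edge points away from the root of `t`
-- when `d` is `fwd` and towards it when `d` is `bwd`.
data Tree (A : Set) : Set where
  single : A → Tree A
  link   : Dir → Tree A → Tree A → Tree A

module _ {A : Set} where

  root : Tree A → A
  root (single a)   = a
  root (link _ t _) = root t

  labels : Tree A → List A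
  labels (single a)   = a ∷ []
  labels (link _ t s) = labels t ++ labels s

  data Edge : Tree A → Dir → A → A → Set where
    joint : ∀ {d t s} → Edge (link d t s) d (root t) (root s)
    left  : ∀ {d t s e a b} → Edge t e a b → Edge (link d t s) e a b
    right : ∀ {d t s e a b} → Edge s e a b → Edge (link d t s) e a b

  reverse : Tree A → Tree A
  reverse (single a)   = single a
  reverse (link d t s) = link (op d) (reverse t) (reverse s)

  kids : Dir → Tree A → List (Tree A)
  kids d   (single a)     = []
  kids fwd (link fwd t s) = s ∷ kids fwd t
  kids fwd (link bwd t s) = kids fwd t
  kids bwd (link fwd t s) = kids bwd t
  kids bwd (link bwd t s) = s ∷ kids bwd t

  -- Nodes plus leaves minus one of the in-arborescence through the root of `t`.
  block : Tree A → ℕ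
  block (single a)     = 1
  block (link fwd t s) = block t
  block (link bwd t s) = block t + block s + positive (kids bwd t)

  -- The number of vertices that the greedy embedding of `t` requires.
  room : Tree A → ℕ
  room (single a)     = 1
  room (link fwd t s) = room t + room s + positive (kids fwd t)
  room (link bwd t s) = suc (room t + room s + 2 * positive (kids bwd t))

  -- The part `own t + 2` of `suc (room t)` is due to the out-children of the root; `tot t` sums
  -- `own` over the in-arborescence through the root.
  own : Tree A → ℕ
  own (single a)     = 0
  own (link fwd t s) = own t + room s + positive (kids fwd t)
  own (link bwd t s) = own t

  tot : Tree A → ℕ
  tot (single a)     = 0
  tot (link fwd t s) = tot t + room s + positive (kids fwd t)
  tot (link bwd t s) = tot t + tot s

  Σ[_] : (Tree A → ℕ) → List (Tree A) → ℕ
  Σ[ f ] ts = sum (map f ts)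

  1≤block : ∀ t → 1 ≤ block t
  1≤block (single a)     = s≤s z≤n
  1≤block (link fwd t s) = 1≤block t
  1≤block (link bwd t s) = ≤-trans (1≤block t) (≤-trans (m≤m+n _ _) (m≤m+n _ _))

  -- This explains the constants in `room`: every vertex of the block counts twice, once as a node
  -- and once as a potential leaf, and `tot` pays for what hangs below by out-edges.
  room-split : ∀ t → suc (room t) ≡ tot t + 2 * block t
  room-split (single a) = refl
  room-split (link fwd t s) = trans (cong (λ x → x + room s + positive (kids fwd t)) (room-split t))
    (shuffle (tot t) (block t) (room s) (positive (kids fwd t)))
    where
    shuffle : ∀ a b c d → a + 2 * b + c + d ≡ a + c + d + 2 * b
    shuffle = solve-∀
  room-split (link bwd t s) = trans (regroup (room t) (room s) p)
    (trans (cong₂ (λ x y → x + y + 2 * p) (room-split t) (room-split s))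
      (shuffle (tot t) (block t) (tot s) (block s) p))
    where
    p = positive (kids bwd t)
    regroup : ∀ a b c → suc (suc (a + b + 2 * c)) ≡ suc a + suc b + 2 * c
    regroup = solve-∀
    shuffle : ∀ a b c d e → a + 2 * b + (c + 2 * d) + 2 * e ≡ a + c + 2 * (b + d + e)
    shuffle = solve-∀

  tot-split : ∀ t → own t + Σ[ tot ] (kids bwd t) ≡ tot t
  tot-split (single a) = refl
  tot-split (link fwd t s) = trans (shuffle (own t) (room s) (positive (kids fwd t)) (Σ[ tot ] (kids bwd t)))
    (cong (λ x → x + room s + positive (kids fwd t)) (tot-split t))
    where
    shuffle : ∀ a b c d → a + b + c + d ≡ a + d + b + c
    shuffle = solve-∀
  tot-split (link bwd t s) = trans (shuffle (own t) (tot s) (Σ[ tot ] (kids bwd t)))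
    (cong (_+ tot s) (tot-split t))
    where
    shuffle : ∀ a b c → a + (b + c) ≡ a + c + b
    shuffle = solve-∀

  -- Here `suc ∘ block` is nodes plus leaves. Deleting the root removes a node, and a leaf only if
  -- the root was alone. This is the drop in cost for the greedy run inside a block.
  block-kids : ∀ t → Σ[ suc ∘ block ] (kids bwd t) ≤ block t
  block-kids (single a) = z≤n
  block-kids (link fwd t s) = block-kids t
  block-kids (link bwd t s) with kids bwd t | block-kids t
  ... | []     | _ = ≤-trans (≤-reflexive (+-identityʳ _))
                       (≤-trans (+-monoˡ-≤ (block s) (1≤block t)) (m≤m+n _ 0))
  ... | us@(_ ∷ _) | h = begin
    suc (block s) + Σ[ suc ∘ block ] us   ≤⟨ +-monoʳ-≤ (suc (block s)) h ⟩
    suc (block s) + block t               ≡⟨ shuffle (block s) (block t) ⟩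
    block t + block s + 1                 ∎
    where
    open ≤-Reasoning
    shuffle : ∀ a b → suc a + b ≡ b + a + 1
    shuffle = solve-∀

  -- The same count for the out-children, each with all that hangs below it. The right-hand side is
  -- one less than the cost `2 + own t` used in the outer greedy run.
  room-kids : ∀ t → Σ[ suc ∘ room ] (kids fwd t) ≤ suc (own t)
  room-kids (single a) = z≤n
  room-kids (link bwd t s) = room-kids t
  room-kids (link fwd t s) with kids fwd t | room-kids t
  ... | []     | _ = s≤s (≤-trans (≤-reflexive (+-identityʳ _)) (≤-trans (m≤n+m (room s) (own t)) (m≤m+n _ 0)))
  ... | us@(_ ∷ _) | h = begin
    suc (room s) + Σ[ suc ∘ room ] us   ≤⟨ +-monoʳ-≤ (suc (room s)) h ⟩
    suc (room s) + suc (own t)          ≡⟨ shuffle (room s) (own t) ⟩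
    suc (own t + room s + 1)            ∎
    where
    open ≤-Reasoning
    shuffle : ∀ a b → suc a + suc b ≡ suc (b + a + 1)
    shuffle = solve-∀

  2*Σ : ∀ (f g : Tree A → ℕ) → (∀ t → 2 * f t ≤ g t) → ∀ ts → 2 * Σ[ f ] ts ≤ Σ[ g ] ts
  2*Σ f g h []       = z≤n
  2*Σ f g h (t ∷ ts) = ≤-trans (≤-reflexive (*-distribˡ-+ 2 (f t) _)) (+-mono-≤ (h t) (2*Σ f g h ts))

  2*block≤room : ∀ t → 2 * block t ≤ suc (room t)
  2*block≤room t = ≤-trans (m≤n+m _ (tot t)) (≤-reflexive (sym (room-split t)))

  block≤room : ∀ t → block t ≤ room t
  block≤room t = s≤s⁻¹ (≤-trans (+-monoˡ-≤ (block t) (1≤block t))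
    (≤-trans (≤-reflexive (cong (block t +_) (sym (+-identityʳ _)))) (2*block≤room t)))

  here-kid : ∀ d t s → s ∈ kids d (link d t s)
  here-kid fwd t s = here refl
  here-kid bwd t s = here refl

  there-kid : ∀ d e t s {u} → u ∈ kids d t → u ∈ kids d (link e t s)
  there-kid fwd fwd t s = there
  there-kid fwd bwd t s i = i
  there-kid bwd fwd t s i = i
  there-kid bwd bwd t s = there

  root∈ : ∀ t → root t ∈ labels t
  root∈ (single a)   = here refl
  root∈ (link _ t s) = ∈-++⁺ˡ (root∈ t)

  edge∈ : ∀ {t d a b} → Edge t d a b → a ∈ labels t × b ∈ labels t
  edge∈ (joint {t = t} {s}) = ∈-++⁺ˡ (root∈ t) , ∈-++⁺ʳ (labels t) (root∈ s)
  edge∈ (left k)            = let i , j = edge∈ k in ∈-++⁺ˡ i , ∈-++⁺ˡ j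
  edge∈ (right {t = t} k)   = let i , j = edge∈ k in ∈-++⁺ʳ (labels t) i , ∈-++⁺ʳ (labels t) j

-- Lists without repetition.

module _ {A : Set} where

  unique-++ˡ : ∀ {xs ys : List A} → Unique (xs ++ ys) → Unique xs
  unique-++ˡ {[]}     _       = []
  unique-++ˡ {x ∷ xs} (p ∷ u) = All.++⁻ˡ xs p ∷ unique-++ˡ u

  unique-++ʳ : ∀ xs {ys : List A} → Unique (xs ++ ys) → Unique ys
  unique-++ʳ []       u       = u
  unique-++ʳ (x ∷ xs) (_ ∷ u) = unique-++ʳ xs u

  unique-disjoint : ∀ xs {ys : List A} {a} → Unique (xs ++ ys) → a ∈ xs → ¬ a ∈ ys
  unique-disjoint (x ∷ xs) (p ∷ _) (here refl) j = All.lookup p (∈-++⁺ʳ xs j) refl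
  unique-disjoint (x ∷ xs) (_ ∷ u) (there i)   j = unique-disjoint xs u i j

  unique-map-∈ : ∀ {B : Set} (f : A → B) {xs x y} → Unique (map f xs) → x ∈ xs → y ∈ xs →
                 f x ≡ f y → x ≡ y
  unique-map-∈ f (_ ∷ _) (here refl) (here refl) _ = refl
  unique-map-∈ f (p ∷ _) (here refl) (there j)   e = ⊥-elim (All.lookup p (∈-map⁺ f j) e)
  unique-map-∈ f (p ∷ _) (there i)   (here refl) e = ⊥-elim (All.lookup p (∈-map⁺ f i) (sym e))
  unique-map-∈ f (_ ∷ u) (there i)   (there j)   e = unique-map-∈ f u i j e

length≡Σ1 : ∀ {X : Set} (xs : List X) → length xs ≡ sum (map (λ _ → 1) xs)
length≡Σ1 []       = refl
length≡Σ1 (_ ∷ xs) = cong suc (length≡Σ1 xs)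

-- Embedding a rooted oriented tree by two nested greedy runs.

module Embedding {V A : Set} (arc : V → V → Bool)
  (total : ∀ u v → u ≢ v → arc u v ≡ true ⊎ arc v u ≡ true) where

  open MedianOrders arc using (Median)

  private
    total′ : ∀ u v → u ≢ v → flip arc u v ≡ true ⊎ flip arc v u ≡ true
    total′ u v u≢v = total v u (u≢v ∘ sym)

  private
    2*kids : ∀ (t : Tree A) → 2 * length (kids bwd t) ≤ Σ[ suc ∘ block ] (kids bwd t)
    2*kids t = ≤-trans (≤-reflexive (cong (2 *_) (length≡Σ1 (kids bwd t))))
      (2*Σ (λ _ → 1) (suc ∘ block) (λ s → s≤s (1≤block s)) (kids bwd t))

  InSpawn : V × Tree A → List (V × Tree A) → Set
  InSpawn (x , t) ks = ∀ {s} → s ∈ kids bwd t → ∃ λ y → (y , s) ∈ ks × arc y x ≡ true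

  Seat : Set
  Seat = V × Maybe (Tree A)

  Closed : List Seat → Set
  Closed ks = ∀ {x t s} → (x , just t) ∈ ks → s ∈ kids bwd t →
              ∃ λ y → (y , just s) ∈ ks × arc y x ≡ true

  -- `nothing` is a vertex of a block left unused; it counts as one node and one leaf.
  fee : Maybe (Tree A) → ℕ
  fee nothing  = 2
  fee (just t) = 2 + own t

  private
    deal : ∀ v (ts : List (Tree A)) vs → length vs ≡ length ts → All (λ w → arc w v ≡ true) vs →
           ∃ λ ks → map proj₁ ks ≡ vs × map proj₂ ks ≡ ts
                  × (∀ {s} → s ∈ ts → ∃ λ y → (y , s) ∈ ks × arc y v ≡ true)
    deal v []       []       _ _ = [] , refl , refl , λ ()
    deal v (t ∷ ts) (w ∷ vs) e (a ∷ as) with deal v ts vs (suc-injective e) as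
    ... | ks , e₁ , e₂ , h = (w , t) ∷ ks , cong (w ∷_) e₁ , cong (t ∷_) e₂ ,
      λ { (here refl) → w , here refl , a ; (there i) → let y , j , b = h i in y , there j , b }

    Σ-map : ∀ (f : Tree A → ℕ) (ks : List (V × Tree A)) {ts} → map proj₂ ks ≡ ts →
            sum (map (f ∘ proj₂) ks) ≡ Σ[ f ] ts
    Σ-map f ks refl = cong sum (map-∘ ks)

    inSpawn : ∀ v t vs → Unique vs → All (λ w → arc w v ≡ true) vs →
      length vs ≡ length (kids bwd t) →
      ∃ λ ks → map proj₁ ks ≡ vs
             × sum (map (suc ∘ block ∘ proj₂) ks) < suc (block t)
             × own t + sum (map (tot ∘ proj₂) ks) ≤ tot t
             × InSpawn (v , t) ks
    inSpawn v t vs _ as e with deal v (kids bwd t) vs e as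
    ... | ks , e₁ , e₂ , h =
      ks , e₁ , s≤s (subst (_≤ block t) (sym (Σ-map (suc ∘ block) ks e₂)) (block-kids t))
         , ≤-reflexive (trans (cong (own t +_) (Σ-map tot ks e₂)) (tot-split t)) , h

    2≤suc-block : ∀ (t : Tree A) → 2 ≤ suc (block t)
    2≤suc-block t = s≤s (1≤block t)

    2kids<suc-block : ∀ (t : Tree A) → 2 * length (kids bwd t) < suc (block t)
    2kids<suc-block t = s≤s (≤-trans (2*kids t) (block-kids t))

    module In = Greedy (flip arc) (length ∘ kids bwd) (suc ∘ block) own tot
      2≤suc-block 2kids<suc-block InSpawn inSpawn

    fees : ∀ R → sum (map (fee ∘ proj₂) R) ≡ 2 * length R + In.load own R
    fees [] = refl
    fees ((_ , nothing) ∷ R) = trans (cong (2 +_) (fees R)) (shuffle (length R) (In.load own R))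
      where
      shuffle : ∀ a b → 2 + (2 * a + b) ≡ 2 * suc a + b
      shuffle = solve-∀
    fees ((_ , just t) ∷ R) = trans (cong (2 + own t +_) (fees R)) (shuffle (own t) (length R) (In.load own R))
      where
      shuffle : ∀ a b c → 2 + a + (2 * b + c) ≡ 2 * suc b + (a + c)
      shuffle = solve-∀

  -- Any `block u` vertices will do: the inner greedy run uses a median order of them in the
  -- reversed tournament, and its result is permuted back into the order `vs`, which the outer run
  -- prescribes. The weight carried along by the inner run bounds the total fee by
  -- `tot u + 2 * block u`.
  seatBlock : ∀ u vs → Unique vs → length vs ≡ block u →
    ∃ λ ks → map proj₁ ks ≡ vs × sum (map (fee ∘ proj₂) ks) ≤ suc (room u)
           × (∃ λ w → (w , just u) ∈ ks) × Closed ks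
  seatBlock u vs uniq len with MedianOrders.medianOrder (flip arc) total′ vs uniq
  ... | [] , p , _ = ⊥-elim (n≮0 (subst (1 ≤_) (trans (sym len) (↭-length p)) (1≤block u)))
  ... | w ∷ ws , p , m with In.play ws ((w , u) ∷ []) m (unique-↭ p uniq)
                             (≤-reflexive (trans (+-identityʳ _) (cong suc (trans (sym len) (↭-length p)))))
  ...   | r with ↭-map-inv proj₁ (↭-trans (↭-reflexive (trans (In.Run.same r)
                   (In.opening-verts ws ((w , u) ∷ [])))) (↭-sym p))
  ...     | ks , e , q =
    ks , sym e , cheap , (w , ∈-resp-↭ q (keeps (here refl))) , closed
    where
    open In.Run r
    open ≤-Reasoning
    length-final : length final ≡ block u
    length-final = begin-equality
      length final                  ≡⟨ length-map proj₁ final ⟨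
      length (map proj₁ final)      ≡⟨ cong length (trans same (In.opening-verts ws ((w , u) ∷ []))) ⟩
      length (w ∷ ws)               ≡⟨ ↭-length p ⟨
      length vs                     ≡⟨ len ⟩
      block u                       ∎
    cheap : sum (map (fee ∘ proj₂) ks) ≤ suc (room u)
    cheap = begin
      sum (map (fee ∘ proj₂) ks)            ≡⟨ sum-↭ (map⁺ (fee ∘ proj₂) q) ⟨
      sum (map (fee ∘ proj₂) final)         ≡⟨ fees final ⟩
      2 * length final + In.load own final  ≤⟨ +-monoʳ-≤ (2 * length final) weight ⟩
      2 * length final + In.load tot (In.hits ((w , u) ∷ []) ++ In.frees ws)
        ≡⟨ cong₂ _+_ (cong (2 *_) length-final) (trans (In.opening-load ws tot ((w , u) ∷ [])) (+-identityʳ _)) ⟩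
      2 * block u + tot u                   ≡⟨ +-comm (2 * block u) (tot u) ⟩
      tot u + 2 * block u                   ≡⟨ room-split u ⟨
      suc (room u)                          ∎
    closed : Closed ks
    closed i j with spawned (∈-resp-↭ (↭-sym q) i)
    ... | ks′ , sp , pl = let y , k , a = sp j in y , ∈-resp-↭ q (pl k) , a

  seatBlocks : ∀ us vs → Unique vs → length vs ≡ Σ[ block ] us →
    ∃ λ ks → map proj₁ ks ≡ vs × sum (map (fee ∘ proj₂) ks) ≤ Σ[ suc ∘ room ] us
           × (∀ {u} → u ∈ us → ∃ λ w → (w , just u) ∈ ks) × Closed ks
  seatBlocks [] [] _ _ = [] , refl , z≤n , (λ ()) , λ ()
  seatBlocks (u ∷ us) vs uniq len
    with seatBlock u (take (block u) vs) (Unique.take⁺ (block u) uniq)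
           (trans (length-take (block u) vs) (m≤n⇒m⊓n≡m (≤-trans (m≤m+n _ _) (≤-reflexive (sym len)))))
       | seatBlocks us (drop (block u) vs) (Unique.drop⁺ (block u) uniq)
           (trans (length-drop (block u) vs) (trans (cong (_∸ block u) len) (m+n∸m≡n (block u) _)))
  ... | ks , e , c , (w , i) , cl | ks′ , e′ , c′ , h , cl′ =
    ks ++ ks′
    , trans (map-++ proj₁ ks ks′) (trans (cong₂ _++_ e e′) (take++drop≡id (block u) vs))
    , ≤-trans (≤-reflexive (trans (cong sum (map-++ _ ks ks′)) (sum-++ (map _ ks) _))) (+-mono-≤ c c′)
    , (λ { (here refl) → w , ∈-++⁺ˡ i ; (there j) → let w′ , k = h j in w′ , ∈-++⁺ʳ ks k })
    , λ i j → both (∈-++⁻ ks i) j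
    where
    both : ∀ {x t s} → (x , just t) ∈ ks ⊎ (x , just t) ∈ ks′ → s ∈ kids bwd t →
           ∃ λ y → (y , just s) ∈ ks ++ ks′ × arc y x ≡ true
    both (inj₁ i) j = let y , k , a = cl i j in y , ∈-++⁺ˡ k , a
    both (inj₂ i) j = let y , k , a = cl′ i j in y , ∈-++⁺ʳ ks k , a

  private
    need : Maybe (Tree A) → ℕ
    need nothing  = 0
    need (just t) = Σ[ block ] (kids fwd t)

    2≤fee : ∀ t → 2 ≤ fee t
    2≤fee nothing  = ≤-refl
    2≤fee (just t) = s≤s (s≤s z≤n)

    2need<fee : ∀ t → 2 * need t < fee t
    2need<fee nothing  = s≤s z≤n
    2need<fee (just t) = s≤s (≤-trans (2*Σ block (suc ∘ room) 2*block≤room (kids fwd t)) (room-kids t))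

  -- Each tree edge either joins two seats of one block, where `Closed` provides it, or goes from a
  -- seat to the seat of an out-child in the spawned family.
  OutSpawn : Seat → List Seat → Set
  OutSpawn (x , t) ks =
    (∀ {t′} → t ≡ just t′ → ∀ {u} → u ∈ kids fwd t′ → ∃ λ w → (w , just u) ∈ ks × arc x w ≡ true)
    × Closed ks

  private
    Σ0 : ∀ {X : Set} (xs : List X) → sum (map (λ _ → 0) xs) ≡ 0
    Σ0 []       = refl
    Σ0 (_ ∷ xs) = Σ0 xs

    outSpawn : ∀ v (t : Maybe (Tree A)) vs → Unique vs → All (λ w → arc v w ≡ true) vs →
      length vs ≡ need t →
      ∃ λ ks → map proj₁ ks ≡ vs × sum (map (fee ∘ proj₂) ks) < fee t
             × 0 + sum (map (λ _ → 0) ks) ≤ 0 × OutSpawn (v , t) ks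
    outSpawn v nothing [] _ _ _ = [] , refl , s≤s z≤n , z≤n , (λ ()) , λ ()
    outSpawn v (just t) vs uniq as len with seatBlocks (kids fwd t) vs uniq len
    ... | ks , e , c , h , cl = ks , e , s≤s (≤-trans c (room-kids t)) , ≤-reflexive (Σ0 ks)
      -- All vertices of the family are out-neighbours of `v`, so it does not matter which seat of
      -- its block `u` received.
      , (λ { refl i → let w , j = h i in w , j , All.lookup as (subst (w ∈_) e (∈-map⁺ proj₁ j)) }) , cl

    module Out = Greedy arc need fee (λ _ → 0) (λ _ → 0) 2≤fee 2need<fee OutSpawn outSpawn

  -- `P x t` reads: the subtree `t` is placed with its root at the vertex `x`.
  Linked : (V → Tree A → Set) → V → Tree A → Set
  Linked P x t = ∀ d {s} → s ∈ kids d t → ∃ λ y → P y s × orient d arc x y ≡ true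

  -- The in-arborescence through the root is seated on the first `block t` vertices of a median
  -- order, and the outer run starts from there. Out-children are found through `spawned`.
  -- In-children share a block with their parent and are found through `origin`.
  place : ∀ t vs → Unique vs → room t ≤ length vs →
    ∃ λ (P : V → Tree A → Set) →
      (∀ {x s s′} → P x s → P x s′ → s ≡ s′) × (∃ λ x → P x t) × (∀ {x s} → P x s → Linked P x s)
  place t vs uniq fits with MedianOrders.medianOrder arc total vs uniq
  ... | ws , p , m with seatBlock t (take (block t) ws) (Unique.take⁺ (block t) (unique-↭ p uniq))
                          (trans (length-take (block t) ws) (m≤n⇒m⊓n≡m
                            (≤-trans (block≤room t) (≤-trans fits (≤-reflexive (↭-length p))))))
  ...   | ks , e , c , (x₀ , i₀) , cl = P , functional , (x₀ , keeps (Out.opening-places rest ks i₀)) , linked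
    where
    rest = drop (block t) ws
    -- `seatBlock` returns the seats in the given order, so the median order survives.
    whole : map proj₁ ks ++ rest ≡ ws
    whole = trans (cong (_++ rest) e) (take++drop≡id (block t) ws)
    open Out.Run (Out.play rest ks (subst Median (sym whole) m) (subst Unique (sym whole) (unique-↭ p uniq))
      (≤-trans c (s≤s (≤-trans fits (≤-reflexive (trans (↭-length p) (cong length (sym whole))))))))
    P : V → Tree A → Set
    P x s = (x , just (just s)) ∈ final
    final-unique : Unique (map proj₁ final)
    final-unique = subst Unique (sym (trans same (trans (Out.opening-verts rest ks) whole)))
      (unique-↭ p uniq)
    functional : ∀ {x s s′} → P x s → P x s′ → s ≡ s′
    functional i j with refl ← unique-map-∈ proj₁ final-unique i j refl = refl
    linked : ∀ {x s} → P x s → Linked P x s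
    linked i fwd j with spawned i
    ... | ks′ , (down , _) , pl = let w , k , a = down refl j in w , pl k , a
    linked i bwd j with origin i
    ... | inj₁ k = let y , l , a = cl (Out.opening-new rest ks k) j in
                   y , keeps (Out.opening-places rest ks l) , a
    ... | inj₂ (_ , ks′ , (_ , cl′) , k , pl) = let y , l , a = cl′ k j in y , pl l , a

  module _ (_≟_ : DecidableEquality A) where
    open DecMembership _≟_ using (_∈?_)

    -- Peeling children off the root leaves trees `t` for which `P x t` may fail. The placed tree
    -- `r` with the same root is therefore kept apart, and only the links that concern the remaining
    -- children are passed on.
    realise : ∀ (P : V → Tree A → Set) → (∀ {x s} → P x s → Linked P x s) →
      ∀ t → Unique (labels t) → ∀ {x r} → P x r → root r ≡ root t → Linked P x t →
      ∃ λ (φ : A → V) → φ (root t) ≡ x × (∀ {a} → a ∈ labels t → ∃ λ s → P (φ a) s × root s ≡ a)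
            × (∀ {d a b} → Edge t d a b → orient d arc (φ a) (φ b) ≡ true)
    realise P linked (single a) _ {x} {r} p e _ =
      (λ _ → x) , refl , (λ { (here refl) → r , p , e }) , λ ()
    realise P linked (link d t s) u {x} {r} p e l
      with y , py , a ← l d (here-kid d t s)
      with realise P linked t (unique-++ˡ u) p e (λ d′ i → l d′ (there-kid d′ d t s i))
         | realise P linked s (unique-++ʳ (labels t) u) py refl (linked py)
    ... | φ , φr , φl , φe | ψ , ψr , ψl , ψe = χ , trans (χ-t (root∈ t)) φr , χ-l , χ-e
      where
      χ : A → V
      χ a with a ∈? labels t
      ... | yes _ = φ a
      ... | no _  = ψ a
      χ-t : ∀ {a} → a ∈ labels t → χ a ≡ φ a
      χ-t {a} i with a ∈? labels t
      ... | yes _ = refl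
      ... | no ∉t = ⊥-elim (∉t i)
      χ-s : ∀ {a} → a ∈ labels s → χ a ≡ ψ a
      χ-s {a} i with a ∈? labels t
      ... | yes j = ⊥-elim (unique-disjoint (labels t) u j i)
      ... | no _  = refl
      χ-l : ∀ {a} → a ∈ labels t ++ labels s → ∃ λ s → P (χ a) s × root s ≡ a
      χ-l i with ∈-++⁻ (labels t) i
      ... | inj₁ j rewrite χ-t j = φl j
      ... | inj₂ j rewrite χ-s j = ψl j
      χ-e : ∀ {d′ a b} → Edge (link d t s) d′ a b → orient d′ arc (χ a) (χ b) ≡ true
      χ-e joint = subst₂ (λ y z → orient d arc y z ≡ true)
        (sym (trans (χ-t (root∈ t)) φr)) (sym (trans (χ-s (root∈ s)) ψr)) a
      χ-e (left k) with a∈ , b∈ ← edge∈ k rewrite χ-t a∈ | χ-t b∈ = φe k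
      χ-e (right k) with a∈ , b∈ ← edge∈ k rewrite χ-s a∈ | χ-s b∈ = ψe k

    -- Injectivity holds because a vertex carries at most one subtree, whose root is the label sent
    -- there.
    embed : ∀ t → Unique (labels t) → ∀ vs → Unique vs → room t ≤ length vs →
      ∃ λ (φ : A → V) → (∀ {a b} → a ∈ labels t → b ∈ labels t → φ a ≡ φ b → a ≡ b)
            × (∀ {d a b} → Edge t d a b → orient d arc (φ a) (φ b) ≡ true)
    embed t ut vs uvs fits with place t vs uvs fits
    ... | P , functional , (x , p) , linked with realise P linked t ut p refl (linked p)
    ...   | φ , _ , φl , φe = φ , inj , φe
      where
      inj : ∀ {a b} → a ∈ labels t → b ∈ labels t → φ a ≡ φ b → a ≡ b
      inj i j e with φl i | φl j
      ... | s , p , refl | s′ , p′ , refl = cong root (functional p (subst (λ y → P y s′) (sym e) p′))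

unique-⊆-length : ∀ {A : Set} {xs ys : List A} → Unique xs → (∀ {x} → x ∈ xs → x ∈ ys) →
                  length xs ≤ length ys
unique-⊆-length {xs = []} _ _ = z≤n
unique-⊆-length {xs = x ∷ xs} (p ∷ u) h with ∈-∃++ (h (here refl))
... | as , bs , refl = ≤-trans (s≤s (unique-⊆-length u h′)) (≤-reflexive (sym (↭-length (shift x as bs))))
  where
  h′ : ∀ {y} → y ∈ xs → y ∈ as ++ bs
  h′ i with ∈-resp-↭ (shift x as bs) (h (there i))
  ... | here e  = ⊥-elim (All.lookup p i (sym e))
  ... | there j = j

-- Leaves, and the total room of a tree and its reverse.

module _ {A : Set} where

  -- The childless nodes; `inner` omits the root. A root of degree one is left out of `leaves`, so
  -- the list can only undercount the leaves.
  leaves inner : Tree A → List A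
  leaves (single a)     = a ∷ []
  leaves t@(link _ _ _) = inner t
  inner (single a)     = []
  inner (link _ t s)   = inner t ++ leaves s

  positive-reverse : ∀ d (t : Tree A) → positive (kids (op d) (reverse t)) ≡ positive (kids d t)
  positive-reverse d   (single a)     = refl
  positive-reverse fwd (link fwd t s) = refl
  positive-reverse fwd (link bwd t s) = positive-reverse fwd t
  positive-reverse bwd (link fwd t s) = positive-reverse bwd t
  positive-reverse bwd (link bwd t s) = refl

  -- With `p` for `positive (kids d t)`, the link costs `p` in one of the tree and its reverse, and
  -- `1 + 2 * p` in the other.
  room-link : ∀ d (t s : Tree A) →
    room (link d t s) + room (reverse (link d t s)) ≡
    room t + room (reverse t) + (room s + room (reverse s)) + (1 + 3 * positive (kids d t))
  room-link fwd t s rewrite positive-reverse fwd t =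
    shuffle (room t) (room (reverse t)) (room s) (room (reverse s)) (positive (kids fwd t))
    where
    shuffle : ∀ a b c d p → a + c + p + suc (b + d + 2 * p) ≡ a + b + (c + d) + (1 + 3 * p)
    shuffle = solve-∀
  room-link bwd t s rewrite positive-reverse bwd t =
    shuffle (room t) (room (reverse t)) (room s) (room (reverse s)) (positive (kids bwd t))
    where
    shuffle : ∀ a b c d p → suc (a + c + 2 * p) + (b + d + p) ≡ a + b + (c + d) + (1 + 3 * p)
    shuffle = solve-∀

  -- A single node gives equality. Linking `s` to a bare root adds 3 to the bound for `s`, which
  -- pays for the one new node. Linking to any other tree costs at most 4, and this is covered
  -- because the two induction hypotheses supply two summands 4 where one is required.
  room-reverse : ∀ (t : Tree A) →
    room t + room (reverse t) + 4 ≤ 3 * length (labels t) + 3 * length (leaves t)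
  room-reverse (single a) = ≤-refl
  room-reverse (link d (single a) s) = begin
    room (link d (single a) s) + room (reverse (link d (single a) s)) + 4
      ≡⟨ cong (_+ 4) (room-link d (single a) s) ⟩
    2 + r + (1 + 3 * positive (kids d (single a))) + 4
      ≡⟨ shuffle r ⟩
    3 + (r + 4)
      ≤⟨ +-monoʳ-≤ 3 (room-reverse s) ⟩
    3 + (3 * length (labels s) + 3 * length (leaves s))
      ≡⟨ shuffle′ (length (labels s)) (length (leaves s)) ⟩
    3 * suc (length (labels s)) + 3 * length (leaves s) ∎
    where
    open ≤-Reasoning
    r = room s + room (reverse s)
    shuffle : ∀ r → 2 + r + (1 + 0) + 4 ≡ 3 + (r + 4)
    shuffle = solve-∀
    shuffle′ : ∀ a b → 3 + (3 * a + 3 * b) ≡ 3 * suc a + 3 * b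
    shuffle′ = solve-∀
  room-reverse (link d t@(link _ _ _) s) = begin
    room (link d t s) + room (reverse (link d t s)) + 4
      ≡⟨ cong (_+ 4) (room-link d t s) ⟩
    q + r + (1 + 3 * positive (kids d t)) + 4
      ≤⟨ +-monoˡ-≤ 4 (+-monoʳ-≤ (q + r) (+-monoʳ-≤ 1 (*-monoʳ-≤ 3 (positive≤1 (kids d t))))) ⟩
    q + r + 4 + 4
      ≡⟨ shuffle q r ⟩
    (q + 4) + (r + 4)
      ≤⟨ +-mono-≤ (room-reverse t) (room-reverse s) ⟩
    3 * length (labels t) + 3 * length (leaves t) + (3 * length (labels s) + 3 * length (leaves s))
      ≡⟨ shuffle′ (length (labels t)) (length (leaves t)) (length (labels s)) (length (leaves s)) ⟩
    3 * (length (labels t) + length (labels s)) + 3 * (length (leaves t) + length (leaves s))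
      ≡⟨ cong₂ (λ x y → 3 * x + 3 * y) (length-++ (labels t)) (length-++ (leaves t)) ⟨
    3 * length (labels t ++ labels s) + 3 * length (leaves t ++ leaves s) ∎
    where
    open ≤-Reasoning
    q = room t + room (reverse t)
    r = room s + room (reverse s)
    shuffle : ∀ q r → q + r + 4 + 4 ≡ (q + 4) + (r + 4)
    shuffle = solve-∀
    shuffle′ : ∀ a b c d → 3 * a + 3 * b + (3 * c + 3 * d) ≡ 3 * (a + c) + 3 * (b + d)
    shuffle′ = solve-∀

  root-reverse : ∀ (t : Tree A) → root (reverse t) ≡ root t
  root-reverse (single a)   = refl
  root-reverse (link d t s) = root-reverse t

  labels-reverse : ∀ (t : Tree A) → labels (reverse t) ≡ labels t
  labels-reverse (single a)   = refl
  labels-reverse (link d t s) = cong₂ _++_ (labels-reverse t) (labels-reverse s)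

  edge-reverse : ∀ {t : Tree A} {d a b} → Edge t d a b → Edge (reverse t) (op d) a b
  edge-reverse (joint {d} {t} {s}) =
    subst₂ (Edge (reverse (link d t s)) (op d)) (root-reverse t) (root-reverse s) joint
  edge-reverse (left k)  = left (edge-reverse k)
  edge-reverse (right k) = right (edge-reverse k)

  leaves⊆ : ∀ (t : Tree A) {a} → a ∈ leaves t → a ∈ labels t
  inner⊆  : ∀ (t : Tree A) {a} → a ∈ inner t → a ∈ labels t
  leaves⊆ (single _)     i = i
  leaves⊆ t@(link _ _ _) i = inner⊆ t i
  inner⊆ (link _ t s) i with ∈-++⁻ (inner t) i
  ... | inj₁ j = ∈-++⁺ˡ (inner⊆ t j)
  ... | inj₂ j = ∈-++⁺ʳ (labels t) (leaves⊆ s j)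

  leaves-unique : ∀ (t : Tree A) → Unique (labels t) → Unique (leaves t)
  inner-unique  : ∀ (t : Tree A) → Unique (labels t) → Unique (inner t)
  leaves-unique (single _)     u = u
  leaves-unique t@(link _ _ _) u = inner-unique t u
  inner-unique (single _)   _ = []
  inner-unique (link _ t s) u =
    Unique.++⁺ (inner-unique t (unique-++ˡ u)) (leaves-unique s (unique-++ʳ (labels t) u))
      (λ { (i , j) → unique-disjoint (labels t) u (inner⊆ t i) (leaves⊆ s j) })

  Incident : Tree A → A → A → Set
  Incident t a b = ∃ λ d → Edge t d a b ⊎ Edge t d b a

  -- The node `p` is arbitrary if `a` has no neighbour, which covers the tree with one node.
  Pendant : Tree A → A → Set
  Pendant t a = ∃ λ p → ∀ {b} → Incident t a b → b ≡ p

  incident∈ : ∀ {t : Tree A} {a b} → Incident t a b → a ∈ labels t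
  incident∈ (_ , inj₁ k) = proj₁ (edge∈ k)
  incident∈ (_ , inj₂ k) = proj₂ (edge∈ k)

  incident-link : ∀ {d} {t s : Tree A} {a b} → Incident (link d t s) a b →
    Incident t a b ⊎ Incident s a b ⊎ (a ≡ root t × b ≡ root s) ⊎ (a ≡ root s × b ≡ root t)
  incident-link (_ , inj₁ joint)     = inj₂ (inj₂ (inj₁ (refl , refl)))
  incident-link (e , inj₁ (left k))  = inj₁ (e , inj₁ k)
  incident-link (e , inj₁ (right k)) = inj₂ (inj₁ (e , inj₁ k))
  incident-link (_ , inj₂ joint)     = inj₂ (inj₂ (inj₂ (refl , refl)))
  incident-link (e , inj₂ (left k))  = inj₁ (e , inj₂ k)
  incident-link (e , inj₂ (right k)) = inj₂ (inj₁ (e , inj₂ k))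

  inner≢root : ∀ (t : Tree A) {a} → Unique (labels t) → a ∈ inner t → a ≢ root t
  inner≢root (link _ t s) u i e with ∈-++⁻ (inner t) i
  ... | inj₁ j = inner≢root t (unique-++ˡ u) j e
  ... | inj₂ j = unique-disjoint (labels t) u (root∈ t) (subst (_∈ labels s) e (leaves⊆ s j))

  -- Distinct labels confine `a` to one side of the link. The joint meets `a` only if `a` is the
  -- root of the lower tree, and being childless it is then all of that tree.
  inner-pendant  : ∀ (t : Tree A) {a} → Unique (labels t) → a ∈ inner t → Pendant t a
  inner-pendant (link d t s) {a} u i with ∈-++⁻ (inner t) i
  inner-pendant (link d t s) {a} u i | inj₁ j with inner-pendant t (unique-++ˡ u) j
  ... | p , h = p , λ k → go (incident-link k)
    where
    a∉s : ¬ a ∈ labels s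
    a∉s = unique-disjoint (labels t) u (inner⊆ t j)
    go : ∀ {b} → _ → b ≡ p
    go (inj₁ k)                       = h k
    go (inj₂ (inj₁ k))                = ⊥-elim (a∉s (incident∈ k))
    go (inj₂ (inj₂ (inj₁ (e , _))))   = ⊥-elim (inner≢root t (unique-++ˡ u) j e)
    go (inj₂ (inj₂ (inj₂ (refl , _)))) = ⊥-elim (a∉s (root∈ s))
  inner-pendant (link d t (single a)) u i | inj₂ (here refl) = root t , λ k → go (incident-link {d} k)
    where
    a∉t : ¬ a ∈ labels t
    a∉t j = unique-disjoint (labels t) u j (here refl)
    go : ∀ {b} → Incident t a b ⊎ Incident (single a) a b ⊎ (a ≡ root t × b ≡ a) ⊎ (a ≡ a × b ≡ root t) →
         b ≡ root t
    go (inj₁ k)                        = ⊥-elim (a∉t (incident∈ k))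
    go (inj₂ (inj₁ (_ , inj₁ ())))
    go (inj₂ (inj₁ (_ , inj₂ ())))
    go (inj₂ (inj₂ (inj₁ (refl , _)))) = ⊥-elim (a∉t (root∈ t))
    go (inj₂ (inj₂ (inj₂ (_ , e))))    = e
  inner-pendant (link d t s@(link _ _ _)) {a} u i | inj₂ j with inner-pendant s (unique-++ʳ (labels t) u) j
  ... | p , h = p , λ k → go (incident-link k)
    where
    a∉t : ¬ a ∈ labels t
    a∉t k = unique-disjoint (labels t) u k (inner⊆ s j)
    go : ∀ {b} → _ → b ≡ p
    go (inj₁ k)                        = ⊥-elim (a∉t (incident∈ k))
    go (inj₂ (inj₁ k))                 = h k
    go (inj₂ (inj₂ (inj₁ (refl , _)))) = ⊥-elim (a∉t (root∈ t))
    go (inj₂ (inj₂ (inj₂ (e , _))))    = ⊥-elim (inner≢root s (unique-++ʳ (labels t) u) j e)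

  leaf-pendant : ∀ (t : Tree A) {a} → Unique (labels t) → a ∈ leaves t → Pendant t a
  leaf-pendant (single b) _ _ = b , λ { (_ , inj₁ ()) ; (_ , inj₂ ()) }
  leaf-pendant t@(link _ _ _) u i = inner-pendant t u i

  -- Attaching a new node to a rooted tree.

  record Grafted (d : Dir) (t : Tree A) (y x : A) : Set where
    field
      tree   : Tree A
      root≡  : root tree ≡ root t
      label↭ : labels tree ↭ x ∷ labels t
      old    : ∀ {e a b} → Edge t e a b → Edge tree e a b
      new    : Edge tree d y x
      only   : ∀ {e a b} → Edge tree e a b → Edge t e a b ⊎ (e ≡ d × a ≡ y × b ≡ x)

  -- The node is linked at the `single` of `y`, so no root changes and every joint above persists.
  graft : ∀ d t {y} x → y ∈ labels t → Grafted d t y x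
  graft d (single a) x (here refl) = record
    { tree = link d (single a) (single x) ; root≡ = refl ; label↭ = swap a x ↭-refl
    ; old = λ () ; new = joint ; only = λ { joint → inj₂ (refl , refl , refl) } }
  graft d (link e t s) {y} x i with ∈-++⁻ (labels t) i
  ... | inj₁ j = record
    { tree = link e tree s ; root≡ = root≡ ; label↭ = ++⁺ʳ (labels s) label↭
    ; old = λ { joint → joint′ ; (left k) → left (old k) ; (right k) → right k }
    ; new = left new 
    ; only = λ { joint → inj₁ joint″ ; (left k) → relay (only k) ; (right k) → inj₁ (right k) } }
    where
    open Grafted (graft d t x j)
    joint′ : Edge (link e tree s) e (root t) (root s)
    joint′ = subst (λ r → Edge (link e tree s) e r (root s)) root≡ joint
    joint″ : Edge (link e t s) e (root tree) (root s)
    joint″ = subst (λ r → Edge (link e t s) e r (root s)) (sym root≡) joint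
    relay : ∀ {f a b} → Edge t f a b ⊎ (f ≡ d × a ≡ y × b ≡ x) →
            Edge (link e t s) f a b ⊎ (f ≡ d × a ≡ y × b ≡ x)
    relay (inj₁ k) = inj₁ (left k)
    relay (inj₂ k) = inj₂ k
  ... | inj₂ j = record
    { tree = link e t tree ; root≡ = refl
    ; label↭ = ↭-trans (++⁺ˡ (labels t) label↭) (shift x (labels t) (labels s))
    ; old = λ { joint → joint′ ; (left k) → left k ; (right k) → right (old k) }
    ; new = right new 
    ; only = λ { joint → inj₁ joint″ ; (left k) → inj₁ (left k) ; (right k) → relay (only k) } }
    where
    open Grafted (graft d s x j)
    joint′ : Edge (link e t tree) e (root t) (root s)
    joint′ = subst (Edge (link e t tree) e (root t)) root≡ joint
    joint″ : Edge (link e t s) e (root t) (root tree)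
    joint″ = subst (Edge (link e t s) e (root t)) (sym root≡) joint
    relay : ∀ {f a b} → Edge s f a b ⊎ (f ≡ d × a ≡ y × b ≡ x) →
            Edge (link e t s) f a b ⊎ (f ≡ d × a ≡ y × b ≡ x)
    relay (inj₁ k) = inj₁ (right k)
    relay (inj₂ k) = inj₂ k

-- Walks and degrees.

module _ {n} (D : Digraph n) where

  adj-sym : ∀ {u v} → adj D u v ≡ true → adj D v u ≡ true
  adj-sym {u} {v} e = trans (∨-comm (D v u) (D u v)) e

  arc⇒adj : ∀ d {u v} → orient d D u v ≡ true → adj D u v ≡ true
  arc⇒adj fwd {u} {v} e = cong (_∨ D v u) e
  arc⇒adj bwd {u} {v} e = trans (cong (D u v ∨_) e) (∨-zeroʳ (D u v))

  adj⇒arc : ∀ {u v} → adj D u v ≡ true → ∃ λ d → orient d D u v ≡ true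
  adj⇒arc {u} {v} e with D u v in eq
  ... | true  = fwd , eq
  ... | false = bwd , e

  walk-++ : ∀ {u v w z vs ws} → Walk D u vs v → adj D v w ≡ true → Walk D w ws z → Walk D u (vs ++ ws) z
  walk-++ (single v)  e p = step e p
  walk-++ (step e′ q) e p = step e′ (walk-++ q e p)

  walk-exit : ∀ {u w vs} (S : List (Fin n)) → Walk D u vs w → u ∈ S → w ∉ S →
              ∃₂ λ y x → y ∈ S × x ∉ S × adj D y x ≡ true
  walk-exit S (single v) i o = ⊥-elim (o i)
  walk-exit S (step {v = v} e p) i o with v ∈? S
    where open DecMembership _≟_ using (_∈?_)
  ... | yes j = walk-exit S p j o
  ... | no j  = _ , v , i , j , e

  degree≤1 : ∀ {v p} → (∀ {u} → adj D v u ≡ true → u ≡ p) → degree D v ≤ 1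
  degree≤1 {v} {p} h = bound (allFin n) (Unique.allFin⁺ n)
    where
    f : Fin n → ℕ
    f u = if adj D v u then 1 else 0
    none : ∀ us → All (p ≢_) us → sum (map f us) ≡ 0
    none [] _ = refl
    none (u ∷ us) (p≢u ∷ o) with adj D v u in eq
    ... | true  = ⊥-elim (p≢u (sym (h eq)))
    ... | false = none us o
    bound : ∀ us → Unique us → sum (map f us) ≤ 1
    bound [] _ = z≤n
    bound (u ∷ us) (u∉us ∷ uniq) with adj D v u in eq
    ... | true  = s≤s (≤-reflexive (none us (subst (λ q → All (q ≢_) us) (h eq) u∉us)))
    ... | false = bound us uniq

  Sound : Tree (Fin n) → Set
  Sound t = ∀ {d a b} → Edge t d a b → orient d D a b ≡ true

  -- A path between the two sides of a link passes through both roots; it repeats no vertex because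
  -- the sides have disjoint labels.
  tree-path : ∀ t → Unique (labels t) → Sound t → ∀ {y z} → y ∈ labels t → z ∈ labels t →
              ∃ λ vs → Walk D y vs z × Unique vs × (∀ {v} → v ∈ vs → v ∈ labels t)
  tree-path (single a) u _ (here refl) (here refl) = a ∷ [] , single a , u , λ i → i
  tree-path (link d t s) u sound {y} {z} i j with ∈-++⁻ (labels t) i | ∈-++⁻ (labels t) j
  ... | inj₁ i′ | inj₁ j′ =
    let vs , w , uv , sub = tree-path t (unique-++ˡ u) (sound ∘ left) i′ j′ in vs , w , uv , ∈-++⁺ˡ ∘ sub
  ... | inj₂ i′ | inj₂ j′ =
    let vs , w , uv , sub = tree-path s (unique-++ʳ (labels t) u) (sound ∘ right) i′ j′ in
    vs , w , uv , ∈-++⁺ʳ (labels t) ∘ sub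
  ... | inj₁ i′ | inj₂ j′
    with tree-path t (unique-++ˡ u) (sound ∘ left) i′ (root∈ t)
       | tree-path s (unique-++ʳ (labels t) u) (sound ∘ right) (root∈ s) j′
  ... | vs , w , uv , sub | vs′ , w′ , uv′ , sub′ =
    vs ++ vs′ , walk-++ w (arc⇒adj d (sound joint)) w′
    , Unique.++⁺ uv uv′ (λ { (k , l) → unique-disjoint (labels t) u (sub k) (sub′ l) })
    , λ k → both (∈-++⁻ vs k)
    where
    both : ∀ {v} → v ∈ vs ⊎ v ∈ vs′ → v ∈ labels t ++ labels s
    both (inj₁ k) = ∈-++⁺ˡ (sub k)
    both (inj₂ k) = ∈-++⁺ʳ (labels t) (sub′ k)
  tree-path (link d t s) u sound {y} {z} i j | inj₂ i′ | inj₁ j′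
    with tree-path s (unique-++ʳ (labels t) u) (sound ∘ right) i′ (root∈ s)
       | tree-path t (unique-++ˡ u) (sound ∘ left) (root∈ t) j′
  ... | vs , w , uv , sub | vs′ , w′ , uv′ , sub′ =
    vs ++ vs′ , walk-++ w (adj-sym (arc⇒adj d (sound joint))) w′
    , Unique.++⁺ uv uv′ (λ { (k , l) → unique-disjoint (labels t) u (sub′ l) (sub k) })
    , λ k → both (∈-++⁻ vs k)
    where
    both : ∀ {v} → v ∈ vs ⊎ v ∈ vs′ → v ∈ labels t ++ labels s
    both (inj₁ k) = ∈-++⁺ʳ (labels t) (sub k)
    both (inj₂ k) = ∈-++⁺ˡ (sub′ k)

-- From a connected acyclic orientation to a rooted tree.

module Rooting {n} (D : OrientedTree n) where
  open OrientedTree D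
  open DecMembership (_≟_ {n}) using (_∈?_)

  record Rooted (t : Tree (Fin n)) : Set where
    field
      unique : Unique (labels t)
      sound  : Sound arc t
      full   : ∀ {a b} → a ∈ labels t → b ∈ labels t → arc a b ≡ true → Edge t fwd a b ⊎ Edge t bwd b a

  -- Otherwise the tree path from `y` to `z`, closed up through `x`, is a cycle on at least three
  -- vertices.
  one-neighbour : ∀ {t x y z} → Rooted t → x ∉ labels t → y ∈ labels t → z ∈ labels t →
                  adj arc y x ≡ true → adj arc z x ≡ true → y ≡ z
  one-neighbour {t} {x} {y} {z} r x∉ i j e e′ with tree-path arc t (Rooted.unique r) (Rooted.sound r) i j
  ... | _ , single _ , _ , _ = refl
  ... | vs@(_ ∷ []) , step _ () , _ , _
  ... | vs@(_ ∷ _ ∷ _) , w , u , sub = ⊥-elim (acyclic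
    ( x , z , x ∷ vs , step (adj-sym arc e) w
    , All.tabulate (λ k x≡v → x∉ (subst (_∈ labels t) (sym x≡v) (sub k))) ∷ u
    , s≤s (s≤s (s≤s z≤n)) , e′))

  extend : ∀ {t x} → Rooted t → x ∉ labels t →
           ∃₂ λ x′ t′ → Rooted t′ × labels t′ ↭ x′ ∷ labels t
  -- The node added is the one at which a walk from the root towards `x` first leaves the tree; it
  -- may differ from `x`.
  extend {t} {x} r x∉ with walk-exit arc (labels t) (proj₂ (connected (root t) x)) (root∈ t) x∉
  ... | y , z , y∈ , z∉ , e with adj⇒arc arc e
  ...   | d , e′ = z , tree , record
    { unique = unique-↭ (↭-sym label↭)
        (All.tabulate (λ k z≡v → z∉ (subst (_∈ labels t) (sym z≡v) k)) ∷ Rooted.unique r)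
    ; sound = sound′ ∘ only
    ; full = λ i j → full′ (∈-resp-↭ label↭ i) (∈-resp-↭ label↭ j) } , label↭
    where
    open Grafted (graft d t z y∈)
    sound′ : ∀ {f a b} → Edge t f a b ⊎ (f ≡ d × a ≡ y × b ≡ z) → orient f arc a b ≡ true
    sound′ (inj₁ k)                    = Rooted.sound r k
    sound′ (inj₂ (refl , refl , refl)) = e′
    clash : ∀ {u v} → arc u v ≡ true → ¬ arc v u ≡ true
    clash p q with () ← trans (sym (oriented _ _ p)) q
    from-y : ∀ f → orient f arc y z ≡ true → arc y z ≡ true → Edge tree f y z →
             Edge tree fwd y z ⊎ Edge tree bwd z y
    from-y fwd _ _ k = inj₁ k
    from-y bwd p q k = ⊥-elim (clash p q)
    to-y : ∀ f → orient f arc y z ≡ true → arc z y ≡ true → Edge tree f y z →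
           Edge tree fwd z y ⊎ Edge tree bwd y z
    to-y fwd p q k = ⊥-elim (clash p q)
    to-y bwd _ _ k = inj₂ k
    -- By `one-neighbour`, the only arc between `z` and the old tree is the one at `y`.
    full′ : ∀ {a b} → a ∈ z ∷ labels t → b ∈ z ∷ labels t → arc a b ≡ true →
            Edge tree fwd a b ⊎ Edge tree bwd b a
    full′ (here refl) (here refl) p with () ← trans (sym (irrefl z)) p
    full′ (here refl) (there j) p with one-neighbour r z∉ y∈ j e (arc⇒adj arc bwd p)
    ... | refl = to-y d e′ p new
    full′ (there i) (here refl) p with one-neighbour r z∉ y∈ i e (arc⇒adj arc fwd p)
    ... | refl = from-y d e′ p new
    full′ (there i) (there j) p with Rooted.full r i j p
    ... | inj₁ k = inj₁ (old k)
    ... | inj₂ k = inj₂ (old k)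

  length≤n : ∀ {xs : List (Fin n)} → Unique xs → length xs ≤ n
  length≤n u = ≤-trans (unique-⊆-length u (λ {x} _ → ∈-allFin x)) (≤-reflexive (length-tabulate (λ i → i)))

  rooted : Fin n → ∃ λ t → Rooted t × (∀ v → v ∈ labels t)
  rooted v = go n (single v) (record { unique = [] ∷ [] ; sound = λ () ; full = base }) (m≤n+m n 1)
    where
    base : ∀ {a b} → a ∈ v ∷ [] → b ∈ v ∷ [] → arc a b ≡ true → Edge (single v) fwd a b ⊎ Edge (single v) bwd b a
    base (here refl) (here refl) p with () ← trans (sym (irrefl v)) p
    go : ∀ k t → Rooted t → n ≤ length (labels t) + k → ∃ λ t → Rooted t × (∀ v → v ∈ labels t)
    go k t r enough with all? (_∈? labels t)
    ... | yes all = t , r , all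
    ... | no ¬all with ¬∀⟶∃¬ n _ (_∈? labels t) ¬all
    ...   | x , x∉ with extend r x∉
    -- With the fuel used up the tree has at least `n` nodes, so another one would exceed `n`.
    go zero t r enough | no _ | x , x∉ | x′ , t′ , r′ , p =
      ⊥-elim (<-irrefl refl (≤-trans (s≤s (subst (n ≤_) (+-identityʳ _) enough))
        (subst (_≤ n) (↭-length p) (length≤n (Rooted.unique r′)))))
    go (suc k) t r enough | no _ | x , x∉ | x′ , t′ , r′ , p =
      go k t′ r′ (≤-trans enough (≤-reflexive (trans (+-suc _ k) (cong (_+ k) (sym (↭-length p))))))

  -- The rooted tree spans, so by `full` all neighbours of a vertex are its neighbours in the rooted
  -- tree, and `leaf-pendant` bounds the degree.
  leaves≤numLeaves : ∀ {t} → Rooted t → (∀ v → v ∈ labels t) → length (leaves t) ≤ numLeaves arc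
  leaves≤numLeaves {t} r all = unique-⊆-length (leaves-unique t unique) λ {a} i →
    ∈-filter⁺ (λ v → degree arc v ≤? 1) (∈-allFin a)
      (degree≤1 arc (λ {b} e → proj₂ (leaf-pendant t unique i) (incident a b e)))
    where
    open Rooted r
    incident : ∀ a b → adj arc a b ≡ true → Incident t a b
    incident a b e with adj⇒arc arc e
    ... | fwd , p with full (all a) (all b) p
    ...   | inj₁ k = fwd , inj₁ k
    ...   | inj₂ k = bwd , inj₂ k
    incident a b e | bwd , p with full (all b) (all a) p
    ... | inj₁ k = fwd , inj₂ k
    ... | inj₂ k = bwd , inj₁ k

-- Choosing between the tree and its reverse.

half-bound : ∀ {a b x} → a + b ≤ x → a ≤ ⌈ x /2⌉ ⊎ b ≤ ⌈ x /2⌉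
half-bound {a} {b} {x} a+b≤x with a ≤? ⌈ x /2⌉ | b ≤? ⌈ x /2⌉
... | yes p | _     = inj₁ p
... | no _  | yes q = inj₂ q
... | no p  | no q  = ⊥-elim (<-irrefl refl (begin-strict
  x                        ≡⟨ ⌊n/2⌋+⌈n/2⌉≡n x ⟨
  ⌊ x /2⌋ + ⌈ x /2⌉        ≤⟨ +-monoˡ-≤ ⌈ x /2⌉ (⌊n/2⌋≤⌈n/2⌉ x) ⟩
  ⌈ x /2⌉ + ⌈ x /2⌉        <⟨ +-mono-< (≰⇒> p) (≰⇒> q) ⟩
  a + b                    ≤⟨ a+b≤x ⟩
  x                        ∎))
  where open ≤-Reasoning

module _ {n m} (D : OrientedTree n) (T : Tournament m) {t} (r : Rooting.Rooted D t)
         (all : ∀ v → v ∈ labels t) where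
  open Rooting.Rooted r
  open Tournament T using (arc; total)

  embedding⇒contains :
    (∃ λ (φ : Fin n → Fin m) → (∀ {a b} → a ∈ labels t → b ∈ labels t → φ a ≡ φ b → a ≡ b)
       × (∀ {d a b} → Edge t d a b → orient d arc (φ a) (φ b) ≡ true)) →
    ContainsDigraph T (OrientedTree.arc D)
  embedding⇒contains (φ , inj , edges) =
    φ , inj (all _) (all _) , λ u v p → arcs u v (full (all u) (all v) p)
    where
    arcs : ∀ u v → Edge t fwd u v ⊎ Edge t bwd v u → arc (φ u) (φ v) ≡ true
    arcs u v (inj₁ k) = edges k
    arcs u v (inj₂ k) = edges k

  length-allFin : length (allFin m) ≡ m
  length-allFin = length-tabulate (λ i → i)

  room⇒contains : room t ≤ m → ContainsDigraph T (OrientedTree.arc D)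
  room⇒contains fits = embedding⇒contains (Embedding.embed arc total _≟_ t unique
    (allFin m) (Unique.allFin⁺ m) (subst (room t ≤_) (sym length-allFin) fits))

  -- Reversing all arcs of both the tree and the tournament preserves containment.
  room-reverse⇒contains : room (reverse t) ≤ m → ContainsDigraph T (OrientedTree.arc D)
  room-reverse⇒contains fits = embedding⇒contains (unflip-embedding
    (Embedding.embed (flip arc) (λ u v u≢v → total v u (u≢v ∘ sym)) _≟_
      (reverse t) (subst Unique (sym (labels-reverse t)) unique)
      (allFin m) (Unique.allFin⁺ m) (subst (room (reverse t) ≤_) (sym length-allFin) fits)))
    where
    ∈-reverse : ∀ {v} → v ∈ labels t → v ∈ labels (reverse t)
    ∈-reverse {v} = subst (v ∈_) (sym (labels-reverse t))
    unflip : ∀ d {u v} → orient (op d) (flip arc) u v ≡ true → orient d arc u v ≡ true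
    unflip fwd e = e
    unflip bwd e = e
    unflip-embedding :
      (∃ λ (φ : Fin n → Fin m) →
         (∀ {a b} → a ∈ labels (reverse t) → b ∈ labels (reverse t) → φ a ≡ φ b → a ≡ b)
         × (∀ {d a b} → Edge (reverse t) d a b → orient d (flip arc) (φ a) (φ b) ≡ true)) →
      ∃ λ (φ : Fin n → Fin m) → (∀ {a b} → a ∈ labels t → b ∈ labels t → φ a ≡ φ b → a ≡ b)
         × (∀ {d a b} → Edge t d a b → orient d arc (φ a) (φ b) ≡ true)
    unflip-embedding (φ , inj , edges) =
      φ , (λ i j → inj (∈-reverse i) (∈-reverse j)) , λ {d} k → unflip d (edges (edge-reverse k))

-- The summand 4 in `room-reverse` stands on the smaller side, so the subtraction does not truncate.
rooms-bound : ∀ {n} (D : OrientedTree n) {t} → Rooting.Rooted D t → (∀ v → v ∈ labels t) →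
  room t + room (reverse t) ≤ (3 * n + 3 * numLeaves (OrientedTree.arc D)) ∸ 4
rooms-bound D {t} r all = m+n≤o⇒m≤o∸n (room t + room (reverse t)) (≤-trans (room-reverse t)
  (+-mono-≤ (*-monoʳ-≤ 3 (Rooting.length≤n D (Rooting.Rooted.unique r)))
            (*-monoʳ-≤ 3 (Rooting.leaves≤numLeaves D r all))))

unavoidable : ∀ {n} (D : OrientedTree n) → Fin n →
  Unavoidable ⌈ (3 * n + 3 * numLeaves (OrientedTree.arc D)) ∸ 4 /2⌉ (OrientedTree.arc D)
unavoidable D v T = choose (Rooting.rooted D v)
  where
  choose : (∃ λ t → Rooting.Rooted D t × (∀ v → v ∈ labels t)) → ContainsDigraph T (OrientedTree.arc D)
  choose (t , r , all) = [ room⇒contains D T r all , room-reverse⇒contains D T r all ]′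
    (half-bound (rooms-bound D r all))

mainTheorem2 : ∀ (n k : ℕ) (D : OrientedTree n) → numLeaves (OrientedTree.arc D) ≡ k →
    Unavoidable ⌈ (3 * n + 3 * k) ∸ 4 /2⌉ (OrientedTree.arc D)
mainTheorem2 zero    k D _    = λ T → (λ ()) , (λ { {()} }) , λ ()
mainTheorem2 (suc n) k D refl   = unavoidable D Fin.zero
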